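{- Under the standing hypotheses described in the context, $D$ is an $\mathbb{F}_2$-linear set of $H_\infty$; that is, there is an $\mathbb{F}_2$-subspace $U$ of $\mathbb{F}_q^{2k}$ with $D=\{\langle u\rangle_{\mathbb{F}_q}: u\in U\setminus\{0\}\}$, where $H_\infty$ is identified with $\mathrm{PG}(\mathbb{F}_q^{2k})$.
   Context: Standing hypotheses: $q=2^h$ with $h\ge4$, $k\ge2$; $H_\infty\cong\mathrm{PG}(2k-1,q)$ is a hyperplane of $\mathrm{PG}(2k,q)$, points outside $H_\infty$ are affine; for distinct affine points $P,R$ the point $PR\cap H_\infty$ is the direction they determine. $\mathcal{Q}$ is a set of $q^k$ affine points, $D\subseteq H_\infty$ is the set of directions determined by pairs of distinct points of $\mathcal{Q}$, $|D|=q^k-1$, and every line of $\mathrm{PG}(2k,q)$ meets $D$ in $0$, $1$, $3$ or $q-1$ points. -}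

module Defs where

open import Level using (0ℓ)
open import Data.Nat as ℕ using (ℕ; suc; _∸_)
open import Data.Fin using (Fin)
open import Data.Product using (Σ; ∃; _×_; _,_)
open import Data.Sum using (_⊎_)
open import Relation.Nullary using (¬_)
open import Relation.Binary.PropositionalEquality using (_≡_)
open import Algebra.Core using (Op₁; Op₂)
open import Algebra.Structures using (IsCommutativeRing)
open import Function.Bundles using (_↔_)
import Data.Vec.Functional as VF

-- A finite field with exactly q elements (Galois field GF(q)), with
-- propositional equality.  Since GF(q) is unique up to isomorphism,
-- quantifying over all such records is the same as fixing F_q.
record GF (q : ℕ) : Set₁ where
  field
    Carrier    : Set
    _+_ _*_    : Op₂ Carrier
    -_         : Op₁ Carrier
    0# 1#      : Carrier
    isCommutativeRing : IsCommutativeRing _≡_ _+_ _*_ -_ 0# 1#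
    0≢1        : ¬ (0# ≡ 1#)
    inverse    : ∀ x → ¬ (x ≡ 0#) → Σ Carrier (λ y → (x * y) ≡ 1#)
    enum       : Fin q ↔ Carrier

module Geometry {q : ℕ} (F : GF q) where
  open GF F

  Vect : ℕ → Set
  Vect n = Fin n → Carrier

  _≋_ : ∀ {n} → Vect n → Vect n → Set
  v ≋ w = ∀ i → v i ≡ w i

  zeroV : ∀ {n} → Vect n
  zeroV _ = 0#

  NonZeroV : ∀ {n} → Vect n → Set
  NonZeroV v = ¬ (v ≋ zeroV)

  _⊕_ : ∀ {n} → Vect n → Vect n → Vect n
  (v ⊕ w) i = v i + w i

  _⊖_ : ∀ {n} → Vect n → Vect n → Vect n
  (v ⊖ w) i = v i + (- (w i))

  _·_ : ∀ {n} → Carrier → Vect n → Vect n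
  (c · v) i = c * v i

  Proportional : ∀ {n} → Vect n → Vect n → Set
  Proportional v w = Σ Carrier (λ c → ¬ (c ≡ 0#) × (v ≋ (c · w)))

  -- A set S of projective points of PG(n-1,q) (given as a predicate on
  -- nonzero vectors of F^n, closed under proportionality) has exactly m
  -- points: there is a list of m pairwise distinct projective points
  -- (nonzero vectors, pairwise non-proportional) lying in S and
  -- covering every point of S.
  HasSize : ∀ {n} → (Vect n → Set) → ℕ → Set
  HasSize {n} S m =
    Σ (Fin m → Vect n) λ L →
      (∀ i → NonZeroV (L i) × S (L i)) ×
      (∀ i j → Proportional (L i) (L j) → i ≡ j) ×
      (∀ v → NonZeroV v → S v → ∃ λ i → Proportional v (L i))

  Independent : ∀ {n} → Vect n → Vect n → Set
  Independent a b = ∀ λ₁ μ → ((λ₁ · a) ⊕ (μ · b)) ≋ zeroV → (λ₁ ≡ 0#) × (μ ≡ 0#)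

  OnLine : ∀ {n} → Vect n → Vect n → Vect n → Set
  OnLine a b v = Σ Carrier λ λ₁ → Σ Carrier λ μ → v ≋ ((λ₁ · a) ⊕ (μ · b))

  -- PG(2k,q) has homogeneous coordinates (x₀,x₁,…,x_{2k}); H∞ is x₀ = 0,
  -- identified with PG(F^{2k}) by dropping x₀.  Affine points are
  -- (1, p) with p ∈ F^{2k}.
  affine : ∀ {n} → Vect n → Vect (suc n)
  affine p = 1# VF.∷ p

  atInfinity : ∀ {n} → Vect n → Vect (suc n)
  atInfinity v = 0# VF.∷ v

  -- D: the set of directions determined by the affine point set Q
  -- (Q given as an injective family of affine points).  The direction of
  -- P ≠ R is PR ∩ H∞ = ⟨P − R⟩ (in homogeneous coordinates (1,p),(1,r)).
  Directions : ∀ {n m} → (Fin m → Vect n) → Vect (suc n) → Set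
  Directions Q v = ∃ λ i → ∃ λ j →
    ¬ (Q i ≋ Q j) × Proportional v (affine (Q i) ⊖ affine (Q j))

  LineCondition : ∀ {n} → (Vect (suc n) → Set) → Set
  LineCondition S = ∀ a b → Independent a b →
    ∃ λ t → (t ≡ 0 ⊎ t ≡ 1 ⊎ t ≡ 3 ⊎ t ≡ q ∸ 1) ×
            HasSize (λ v → S v × OnLine a b v) t

  IsF₂Subspace : ∀ {n} → (Vect n → Set) → Set
  IsF₂Subspace U =
    U zeroV ×
    (∀ u w → U u → U w → U (u ⊕ w)) ×
    (∀ c u → (c ≡ 0# ⊎ c ≡ 1#) → U u → U (c · u))

{-# OPTIONS --safe #-}
module Submission where

-- Counting incidences between points and directions shows that no three points of Q are collinear, so
-- each point A of Q sees every direction of D exactly once.  We show that Q is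
-- an affine F₂-subspace, so that U = Q − A.  Call a line at infinity red if it has q − 1 points in D.
-- A plane through A, A + βd, X ∈ Q whose line at infinity is not red has at most three directions,
-- which forces the parallelogram point X + βd into Q.  If the line is red, one reaches X from A via
-- a point W of a parallel plane such that neither AW nor WX spans a red line with d.  Such W exist
-- because, in a plane at infinity, at most four red lines pass through a point d of D.

open import Defs
open import Data.Nat as ℕ using (ℕ; zero; suc; _^_; _≤_; _<_; _∸_; z≤n; s≤s)
import Data.Nat.Properties as ℕₚ
open import Data.Bool using (Bool; true; false)
open import Data.Bool.Properties using (xor-∧-commutativeRing)
open import Data.Fin using (Fin; zero; suc)
import Data.Fin.Properties as Fin
open import Data.Fin.Permutation using (Permutation; permutation; _⟨$⟩ʳ_)
open import Data.List as List using (List; []; _∷_; length)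
import Data.List.Properties as List
open import Data.List.Relation.Unary.All as All using (All; []; _∷_)
import Data.List.Relation.Unary.All.Properties as All
open import Data.List.Relation.Unary.AllPairs using ([]; _∷_)
open import Data.List.Relation.Unary.Any using (Any; here; there; any?)
open import Data.List.Relation.Unary.Unique.Propositional using (Unique)
import Data.List.Relation.Unary.Unique.Propositional.Properties as Unique
open import Data.Maybe using (Maybe; just; nothing)
open import Data.Maybe.Properties using (just-injective) renaming (≡-dec to Maybe-≡-dec)
open import Data.Product using (Σ; ∃; _×_; _,_; proj₁; proj₂)
open import Data.Sum using (_⊎_; inj₁; inj₂)
open import Data.Empty using (⊥; ⊥-elim)
open import Data.Unit using (⊤; tt)
open import Relation.Nullary using (¬_; Dec; yes; no; contradiction)
open import Relation.Nullary.Decidable using (_×-dec_; _⊎-dec_; ¬?; map′; decidable-stable)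
open import Relation.Binary.PropositionalEquality hiding ([_])
open import Algebra.Bundles using (CommutativeRing; RawRing)
open import Function.Bundles using (Inverse)

-- The line condition enters only through two consequences: a line with at least four directions has
-- exactly `q ∸ 1` of them, and every line has fewer than `q`, so every line through a point of D
-- also contains points outside D. Such a point c serves as a direction of projection, since an
-- affine line with direction c holds at most one point of Q. Projection along c bounds the points
-- of Q in a plane by q. It also shows that lines through c with `q ∸ 1` directions generate further
-- such lines, which is what limits the red lines through d. The obstacle on a red line is that many
-- directions are already available there, so a displacement by the wrong multiple of d contradicts
-- nothing; hence the detour through W. The bound q ≥ 16 comes from the choice of W. Besides the
-- given red line at most three others matter, each accounting for at most two points of Q. So A and
-- X exclude at most 6 points each, while the parallel plane has at least q - 2 ≥ 14 points of Q.

-- Counting decidable predicates on `Fin n`.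

module Counting where

  open import Data.Nat using (_+_; _*_)
  open import Data.Nat.Properties
  open import Algebra.Properties.CommutativeMonoid.Sum +-0-commutativeMonoid
    using (sum; ∑-comm; ∑-distrib-+)

  ⊤? : ∀ {n} (i : Fin n) → Dec ⊤
  ⊤? _ = yes tt

  [_] : {A : Set} → Dec A → ℕ
  [ yes _ ] = 1
  [ no _ ]  = 0

  ♯ : ∀ {n} {P : Fin n → Set} → (∀ i → Dec (P i)) → ℕ
  ♯ P? = sum (λ i → [ P? i ])

  sum-mono : ∀ {n} {f g : Fin n → ℕ} → (∀ i → f i ≤ g i) → sum f ≤ sum g
  sum-mono {zero}  h = z≤n
  sum-mono {suc n} h = +-mono-≤ (h zero) (sum-mono (λ i → h (suc i)))

  []-mono : {A B : Set} (a? : Dec A) (b? : Dec B) → (A → B) → [ a? ] ≤ [ b? ]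
  []-mono (no _)  _       f = z≤n
  []-mono (yes a) (yes _) f = ≤-refl
  []-mono (yes a) (no ¬b) f = contradiction (f a) ¬b

  ♯-mono : ∀ {n} {P R : Fin n → Set} (P? : ∀ i → Dec (P i)) (R? : ∀ i → Dec (R i)) →
           (∀ i → P i → R i) → ♯ P? ≤ ♯ R?
  ♯-mono P? R? h = sum-mono (λ i → []-mono (P? i) (R? i) (h i))

  ♯-∪ : ∀ {n} {P R S : Fin n → Set}
        (P? : ∀ i → Dec (P i)) (R? : ∀ i → Dec (R i)) (S? : ∀ i → Dec (S i)) →
        (∀ i → P i → R i ⊎ S i) → ♯ P? ≤ ♯ R? + ♯ S?
  ♯-∪ P? R? S? h = ≤-trans (sum-mono (λ i → pt (P? i) (R? i) (S? i) (h i)))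
                           (≤-reflexive (∑-distrib-+ (λ i → [ R? i ]) (λ i → [ S? i ])))
    where
    pt : {A B C : Set} (a? : Dec A) (b? : Dec B) (c? : Dec C) →
         (A → B ⊎ C) → [ a? ] ≤ [ b? ] + [ c? ]
    pt (no _)  _       _       f = z≤n
    pt (yes a) (yes _) _       f = s≤s z≤n
    pt (yes a) (no ¬b) (yes _) f = ≤-refl
    pt (yes a) (no ¬b) (no ¬c) f with f a
    ... | inj₁ b = contradiction b ¬b
    ... | inj₂ c = contradiction c ¬c

  ♯-⊎ : ∀ {n} {P R S : Fin n → Set}
        (P? : ∀ i → Dec (P i)) (R? : ∀ i → Dec (R i)) (S? : ∀ i → Dec (S i)) →
        (∀ i → R i → P i) → (∀ i → S i → P i) → (∀ i → R i → S i → ⊥) →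
        ♯ R? + ♯ S? ≤ ♯ P?
  ♯-⊎ P? R? S? h k d =
    ≤-trans (≤-reflexive (sym (∑-distrib-+ (λ i → [ R? i ]) (λ i → [ S? i ]))))
            (sum-mono (λ i → pt (P? i) (R? i) (S? i) (h i) (k i) (d i)))
    where
    pt : {A B C : Set} (a? : Dec A) (b? : Dec B) (c? : Dec C) →
         (B → A) → (C → A) → (B → C → ⊥) → [ b? ] + [ c? ] ≤ [ a? ]
    pt a?      (yes b) (yes c) f g e = contradiction c (e b)
    pt a?      (yes b) (no _)  f g e = []-mono (yes b) a? f
    pt a?      (no _)  c?      f g e = []-mono c? a? g

  ♯≤n : ∀ {n} {P : Fin n → Set} (P? : ∀ i → Dec (P i)) → ♯ P? ≤ n
  ♯≤n {zero}  P? = z≤n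
  ♯≤n {suc n} P? with P? zero
  ... | yes _ = s≤s (♯≤n (λ i → P? (suc i)))
  ... | no _  = m≤n⇒m≤1+n (♯≤n (λ i → P? (suc i)))

  ♯-full : ∀ {n} {P : Fin n → Set} (P? : ∀ i → Dec (P i)) → (∀ i → P i) → n ≤ ♯ P?
  ♯-full {zero}  P? h = z≤n
  ♯-full {suc n} P? h with P? zero
  ... | yes _ = s≤s (♯-full (λ i → P? (suc i)) (λ i → h (suc i)))
  ... | no ¬p = contradiction (h zero) ¬p

  ♯-∅ : ∀ {n} {P : Fin n → Set} (P? : ∀ i → Dec (P i)) → (∀ i → ¬ P i) → ♯ P? ≡ 0
  ♯-∅ {zero}  P? h = refl
  ♯-∅ {suc n} P? h with P? zero
  ... | yes p = contradiction p (h zero)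
  ... | no _  = ♯-∅ (λ i → P? (suc i)) (λ i → h (suc i))

  ♯-∋ : ∀ {n} {P : Fin n → Set} (P? : ∀ i → Dec (P i)) i → P i → 1 ≤ ♯ P?
  ♯-∋ P? zero p with P? zero
  ... | yes _ = s≤s z≤n
  ... | no ¬p = contradiction p ¬p
  ♯-∋ P? (suc i) p = ≤-trans (♯-∋ (λ j → P? (suc j)) i p) (m≤n+m _ [ P? zero ])

  ♯-singleton : ∀ {n} (i : Fin n) → ♯ (Fin._≟ i) ≤ 1
  ♯-singleton {suc n} zero    = s≤s (≤-reflexive (♯-∅ (λ (j : Fin n) → suc j Fin.≟ zero) (λ _ ())))
  ♯-singleton {suc n} (suc i) =
    ≤-trans (♯-mono (λ j → suc j Fin.≟ suc i) (Fin._≟ i) (λ _ → Fin.suc-injective))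
            (♯-singleton i)

  abstract
    ♯-witness : ∀ {n} {P : Fin n → Set} (P? : ∀ i → Dec (P i)) → 1 ≤ ♯ P? → ∃ P
    ♯-witness P? h with Fin.any? P?
    ... | yes w = w
    ... | no ¬w = contradiction (≤-trans h (≤-reflexive (♯-∅ P? (λ i p → ¬w (i , p))))) λ ()

  abstract
    ♯-witness-∖ : ∀ {n} {P R : Fin n → Set} (P? : ∀ i → Dec (P i)) (R? : ∀ i → Dec (R i)) →
                  ♯ P? < ♯ R? → ∃ λ i → R i × ¬ P i
    ♯-witness-∖ {P = P} {R} P? R? h with Fin.any? (λ i → R? i ×-dec ¬? (P? i))
    ... | yes w = w
    ... | no ¬w = contradiction (<-≤-trans h (♯-mono R? P? imp)) (<-irrefl refl)
      where
      imp : ∀ i → R i → P i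
      imp i r with P? i
      ... | yes p = p
      ... | no ¬p = contradiction (i , r , ¬p) ¬w

  ♯-∁ : ∀ {n} {P : Fin n → Set} (P? : ∀ i → Dec (P i)) → ♯ P? + ♯ (λ i → ¬? (P? i)) ≡ n
  ♯-∁ {n} P? = ≤-antisym
    (≤-trans (♯-⊎ ⊤? P? (λ i → ¬? (P? i)) _ _ (λ _ p ¬p → ¬p p)) (♯≤n ⊤?))
    (≤-trans (♯-full ⊤? _) (♯-∪ ⊤? P? (λ i → ¬? (P? i)) (λ i _ → em (P? i))))
    where
    em : {A : Set} → Dec A → A ⊎ ¬ A
    em (yes a) = inj₁ a
    em (no ¬a) = inj₂ ¬a

  infix 6 _∖_
  _∖_ : ∀ {n} {P : Fin n → Set} → (∀ i → Dec (P i)) → (j : Fin n) →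
        ∀ i → Dec (P i × ¬ (i ≡ j))
  (P? ∖ j) i = P? i ×-dec ¬? (i Fin.≟ j)

  ♯-∖-≤ : ∀ {n} {P : Fin n → Set} (P? : ∀ i → Dec (P i)) j → ♯ P? ≤ suc (♯ (P? ∖ j))
  ♯-∖-≤ {P = P} P? j = ≤-trans (♯-∪ P? (Fin._≟ j) (P? ∖ j) split) (+-monoˡ-≤ _ (♯-singleton j))
    where
    split : ∀ i → P i → _ ⊎ _
    split i p with i Fin.≟ j
    ... | yes e = inj₁ e
    ... | no ¬e = inj₂ (p , ¬e)

  ♯-∖-≥ : ∀ {n} {P : Fin n → Set} (P? : ∀ i → Dec (P i)) j → P j → suc (♯ (P? ∖ j)) ≤ ♯ P?
  ♯-∖-≥ {P = P} P? j p =
    ≤-trans (+-monoˡ-≤ _ (♯-∋ (Fin._≟ j) j refl))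
            (♯-⊎ P? (Fin._≟ j) (P? ∖ j) (λ i e → subst P (sym e) p) (λ _ → proj₁) (λ _ e r → proj₂ r e))

  unique⇒♯≥ : ∀ {n} {P : Fin n → Set} (P? : ∀ i → Dec (P i)) xs →
              Unique xs → All P xs → length xs ≤ ♯ P?
  unique⇒♯≥ P? []       _        _        = z≤n
  unique⇒♯≥ P? (x ∷ xs) (u ∷ us) (p ∷ ps) =
    ≤-trans (s≤s (unique⇒♯≥ (P? ∖ x) xs us
                   (All.zip (ps , All.map (λ ne e → ne (sym e)) u))))
            (♯-∖-≥ P? x p)

  ♯≥⇒unique : ∀ {n} {P : Fin n → Set} (P? : ∀ i → Dec (P i)) k → k ≤ ♯ P? →
              ∃ λ xs → length xs ≡ k × Unique xs × All P xs
  ♯≥⇒unique P? zero    h = [] , refl , [] , []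
  ♯≥⇒unique P? (suc k) h =
    let x , p = ♯-witness P? (≤-trans (s≤s z≤n) h)
        xs , l , u , a = ♯≥⇒unique (P? ∖ x) k (≤-pred (≤-trans h (♯-∖-≤ P? x)))
    in x ∷ xs , cong suc l , All.map (λ r e → proj₂ r (sym e)) a ∷ u , p ∷ All.map proj₁ a

  ♯-subsingleton : ∀ {n} {P : Fin n → Set} (P? : ∀ i → Dec (P i)) →
                   (∀ i j → P i → P j → i ≡ j) → ♯ P? ≤ 1
  ♯-subsingleton P? h with 2 ≤? ♯ P?
  ... | no  2≰ = ≤-pred (≰⇒> 2≰)
  ... | yes 2≤ with ♯≥⇒unique P? 2 2≤
  ... | x ∷ y ∷ [] , _ , ((x≢y ∷ []) ∷ _) , (p ∷ p′ ∷ []) = contradiction (h x y p p′) x≢y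

  all-of-♯ : ∀ {n} {P : Fin n → Set} (P? : ∀ i → Dec (P i)) → n ≤ ♯ P? → ∀ i → P i
  all-of-♯ {n} P? h i with P? i
  ... | yes p = p
  ... | no ¬p = contradiction (≤-trans (+-mono-≤ h (♯-∋ (λ j → ¬? (P? j)) i ¬p)) (≤-reflexive (♯-∁ P?)))
                  (λ n+1≤n → <-irrefl refl (≤-trans (≤-reflexive (+-comm 1 n)) n+1≤n))

  sum-≥ : ∀ {n a} {P : Fin n → Set} (P? : ∀ i → Dec (P i)) {f : Fin n → ℕ} →
          (∀ i → P i → a ≤ f i) → a * ♯ P? ≤ sum f
  sum-≥ {zero}  {a} P? h = ≤-reflexive (*-zeroʳ a)
  sum-≥ {suc n} {a} P? h =
    ≤-trans (≤-reflexive (*-distribˡ-+ a [ P? zero ] _))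
            (+-mono-≤ (pt (P? zero) (h zero)) (sum-≥ (λ i → P? (suc i)) (λ i → h (suc i))))
    where
    pt : ∀ {A : Set} {m} (a? : Dec A) → (A → a ≤ m) → a * [ a? ] ≤ m
    pt (yes p) k = ≤-trans (≤-reflexive (*-identityʳ a)) (k p)
    pt (no _)  k = ≤-trans (≤-reflexive (*-zeroʳ a)) z≤n

  sum-≤ : ∀ {n b} {P : Fin n → Set} (P? : ∀ i → Dec (P i)) {f : Fin n → ℕ} →
          (∀ i → P i → f i ≤ b) → (∀ i → ¬ P i → f i ≤ 0) → sum f ≤ b * ♯ P?
  sum-≤ {zero}      P? h k = z≤n
  sum-≤ {suc n} {b} P? h k =
    ≤-trans (+-mono-≤ (pt (P? zero) (h zero) (k zero))
                      (sum-≤ (λ i → P? (suc i)) (λ i → h (suc i)) (λ i → k (suc i))))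
            (≤-reflexive (sym (*-distribˡ-+ b [ P? zero ] _)))
    where
    pt : ∀ {A : Set} {m} (a? : Dec A) → (A → m ≤ b) → (¬ A → m ≤ 0) → m ≤ b * [ a? ]
    pt (yes p) f g = ≤-trans (f p) (≤-reflexive (sym (*-identityʳ b)))
    pt (no ¬p) f g = ≤-trans (g ¬p) z≤n

  -- Exchange of summation in the 0-1 matrix of pairs with `P i`, `R j` and `T i j`: rows in `P` sum
  -- to at least `a`, columns in `R` to at most `b`, and all other columns vanish.
  double-count : ∀ {m n a b} {P : Fin m → Set} {R : Fin n → Set} {T : Fin m → Fin n → Set}
    (P? : ∀ i → Dec (P i)) (R? : ∀ j → Dec (R j)) (T? : ∀ i j → Dec (T i j)) →
    (∀ i → P i → a ≤ ♯ (λ j → R? j ×-dec T? i j)) →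
    (∀ j → R j → ♯ (λ i → P? i ×-dec T? i j) ≤ b) →
    a * ♯ P? ≤ b * ♯ R?
  double-count {m} {n} {a} {b} P? R? T? row col = begin
    a * ♯ P?                       ≤⟨ sum-≥ P? (λ i p → ≤-trans (row i p)
                                        (♯-mono (λ j → R? j ×-dec T? i j) (λ j → S? i j)
                                                (λ j rt → p , rt))) ⟩
    sum (λ i → sum (λ j → [ S? i j ])) ≡⟨ ∑-comm (λ i j → [ S? i j ]) ⟩
    sum (λ j → sum (λ i → [ S? i j ])) ≤⟨ sum-≤ R? (λ j r → ≤-trans
                                        (♯-mono (λ i → S? i j) (λ i → P? i ×-dec T? i j)
                                                (λ i s → proj₁ s , proj₂ (proj₂ s)))
                                        (col j r))
                                        (λ j ¬r → ≤-reflexive (♯-∅ (λ i → S? i j) (λ i s → ¬r (proj₁ (proj₂ s))))) ⟩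
    b * ♯ R? ∎
    where
    open ≤-Reasoning
    S? : ∀ i j → Dec _
    S? i j = P? i ×-dec (R? j ×-dec T? i j)

  -- This is `double-count` with both bounds 1, applied to the graph of `f`. Since `f i p` may
  -- depend on the proof `p`, the graph always takes the proof delivered by `P? i`.
  ♯-injection : ∀ {m n} {P : Fin m → Set} {R : Fin n → Set}
    (P? : ∀ i → Dec (P i)) (R? : ∀ j → Dec (R j)) →
    (f : ∀ i → P i → Fin n) → (∀ i p → R (f i p)) →
    (∀ i i′ p p′ → f i p ≡ f i′ p′ → i ≡ i′) → ♯ P? ≤ ♯ R?
  ♯-injection {n = n} {P} {R} P? R? f f∈R inj = begin
    ♯ P?     ≡⟨ +-identityʳ _ ⟨
    1 * ♯ P? ≤⟨ double-count P? R? T? row col ⟩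
    1 * ♯ R? ≡⟨ +-identityʳ _ ⟩
    ♯ R?     ∎
    where
    open ≤-Reasoning
    graph : ∀ {i} → Dec (P i) → Maybe (Fin n)
    graph (yes p) = just (f _ p)
    graph (no _)  = nothing

    T? : ∀ i j → Dec (graph (P? i) ≡ just j)
    T? i j = Maybe-≡-dec Fin._≟_ (graph (P? i)) (just j)

    value : ∀ {i j} (d : Dec (P i)) → graph d ≡ just j → Σ (P i) λ p → f i p ≡ j
    value (yes p) e = p , just-injective e

    defined : ∀ {i} (d : Dec (P i)) → P i → ∃ λ j → R j × graph d ≡ just j
    defined (yes p) _ = f _ p , f∈R _ p , refl
    defined (no ¬p) p = contradiction p ¬p

    row : ∀ i → P i → 1 ≤ _
    row i p = let j , rt = defined (P? i) p in ♯-∋ (λ j → R? j ×-dec T? i j) j rt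

    col : ∀ j → R j → _ ≤ 1
    col j _ = ♯-subsingleton (λ i → P? i ×-dec T? i j) λ i i′ s s′ →
      let p , e = value (P? i) (proj₂ s) ; p′ , e′ = value (P? i′) (proj₂ s′)
      in inj i i′ p p′ (trans e (sym e′))

  -- Union bound: the bad sets together cover at most `length xs * b` of the `n` indices.
  ♯-avoid : ∀ {n b} {A : Set} {B : A → Fin n → Set} (B? : ∀ x i → Dec (B x i)) (xs : List A) →
            All (λ x → ♯ (B? x) ≤ b) xs → length xs * b < n → ∃ λ i → All (λ x → ¬ B x i) xs
  ♯-avoid {b = b} {B = B} B? xs h l =
    let i , _ , ¬bad = ♯-witness-∖ (bad? xs) ⊤? (<-≤-trans (≤-<-trans (bound xs h) l) (♯-full ⊤? _))
    in i , All.¬Any⇒All¬ xs ¬bad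
    where
    bad? : ∀ xs i → Dec (Any (λ x → B x i) xs)
    bad? xs i = any? (λ x → B? x i) xs

    bound : ∀ xs → All (λ x → ♯ (B? x) ≤ b) xs → ♯ (bad? xs) ≤ length xs * b
    bound []       _        = ≤-reflexive (♯-∅ (bad? []) (λ _ ()))
    bound (x ∷ xs) (p ∷ ps) = ≤-trans
      (♯-∪ (bad? (x ∷ xs)) (B? x) (bad? xs) (λ { _ (here q) → inj₁ q ; _ (there q) → inj₂ q }))
      (+-mono-≤ p (bound xs ps))

open Counting

-- Finite fields: decidable equality, search and the characteristic.

module FiniteField {q : ℕ} (F : GF q) where

  open GF F public
    renaming (_+_ to infixl 6 _+_; _*_ to infixl 7 _*_; -_ to infix 8 -_)

  ring : CommutativeRing _ _
  ring = record { isCommutativeRing = isCommutativeRing }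

  open CommutativeRing ring public using
    (+-assoc; +-comm; *-comm; *-assoc; +-identityʳ; +-identityˡ; *-identityʳ; *-identityˡ; -‿inverseʳ;
     -‿inverseˡ; zeroˡ; zeroʳ; distribˡ; distribʳ; isCommutativeSemiring)

  el : Fin q → Carrier
  el = Inverse.to enum

  ix : Carrier → Fin q
  ix = Inverse.from enum

  el-ix : ∀ x → el (ix x) ≡ x
  el-ix x = Inverse.inverseˡ enum refl

  ix-el : ∀ i → ix (el i) ≡ i
  ix-el i = Inverse.inverseʳ enum refl

  ix-injective : ∀ {x y} → ix x ≡ ix y → x ≡ y
  ix-injective {x} {y} e = trans (sym (el-ix x)) (trans (cong el e) (el-ix y))

  el-injective : ∀ {i j} → el i ≡ el j → i ≡ j
  el-injective {i} {j} e = trans (sym (ix-el i)) (trans (cong ix e) (ix-el j))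

  infix 4 _≟_
  _≟_ : (x y : Carrier) → Dec (x ≡ y)
  x ≟ y = map′ ix-injective (cong ix) (ix x Fin.≟ ix y)

  abstract
    ∃? : {P : Carrier → Set} → (∀ x → Dec (P x)) → Dec (∃ P)
    ∃? {P} P? = map′ (λ (i , p) → el i , p) (λ (x , p) → ix x , subst P (sym (el-ix x)) p)
                     (Fin.any? (λ i → P? (el i)))

  x*y≡0⇒y≡0 : ∀ {x y} → ¬ (x ≡ 0#) → x * y ≡ 0# → y ≡ 0#
  x*y≡0⇒y≡0 {x} {y} x≢0 xy≡0 = let x⁻¹ , xx⁻¹ = inverse x x≢0 in begin
    y              ≡⟨ *-identityˡ y ⟨
    1# * y         ≡⟨ cong (_* y) xx⁻¹ ⟨
    (x * x⁻¹) * y  ≡⟨ cong (_* y) (*-comm x x⁻¹) ⟩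
    (x⁻¹ * x) * y  ≡⟨ *-assoc x⁻¹ x y ⟩
    x⁻¹ * (x * y)  ≡⟨ cong (x⁻¹ *_) xy≡0 ⟩
    x⁻¹ * 0#       ≡⟨ zeroʳ x⁻¹ ⟩
    0#             ∎
    where open ≡-Reasoning

-- Translating the sum of all field elements by 1 does not change it, so q·1 = 0.
char-2 : ∀ h (F : GF (2 ^ h)) → GF._+_ F (GF.1# F) (GF.1# F) ≡ GF.0# F
char-2 h F = power h (trans (sym (sum-replicate (2 ^ h))) sum-1≡0)
  where
  open FiniteField F
  open CommutativeRing ring using (+-commutativeMonoid; semiring)
  open import Algebra.Properties.CommutativeMonoid.Sum +-commutativeMonoid
  open import Algebra.Properties.Semiring.Mult semiring using (×1-homo-*) renaming (_×_ to _×′_)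
  open ≡-Reasoning

  shift : Permutation (2 ^ h) (2 ^ h)
  shift = permutation (λ i → ix (el i + 1#)) (λ i → ix (el i + - 1#))
    (λ i → trans (cong ix (trans (cong (_+ 1#) (el-ix _)) (cancel (el i) (-‿inverseˡ 1#)))) (ix-el i))
    (λ i → trans (cong ix (trans (cong (_+ - 1#) (el-ix _)) (cancel (el i) (-‿inverseʳ 1#)))) (ix-el i))
    where
    cancel : ∀ x {y z} → y + z ≡ 0# → x + y + z ≡ x
    cancel x {y} {z} e = trans (+-assoc x y z) (trans (cong (x +_) e) (+-identityʳ x))

  s = sum el

  sum-1≡0 : sum {2 ^ h} (λ _ → 1#) ≡ 0#
  sum-1≡0 = begin
    t              ≡⟨ +-identityˡ t ⟨
    0# + t         ≡⟨ cong (_+ t) (-‿inverseˡ s) ⟨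
    (- s + s) + t  ≡⟨ +-assoc (- s) s t ⟩
    - s + (s + t)  ≡⟨ cong (- s +_) (∑-distrib-+ el (λ _ → 1#)) ⟨
    - s + sum (λ i → el i + 1#)          ≡⟨ cong (- s +_) (sum-cong-≗ (λ i → el-ix (el i + 1#))) ⟨
    - s + sum (λ i → el (shift ⟨$⟩ʳ i))  ≡⟨ cong (- s +_) (sum-permute el shift) ⟨
    - s + s        ≡⟨ -‿inverseˡ s ⟩
    0#             ∎
    where t = sum {2 ^ h} (λ _ → 1#)

  -- If 1 + 1 were nonzero it could be cancelled from the product (1 + 1) · (2 ^ m · 1) = 0,
  -- lowering the exponent until 1 = 0.
  power : ∀ m → (2 ^ m) ×′ 1# ≡ 0# → 1# + 1# ≡ 0#
  power zero    e = contradiction (trans (sym e) (+-identityʳ 1#)) 0≢1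
  power (suc m) e with 1# + 1# ≟ 0#
  ... | yes z = z
  ... | no ¬z = power m (x*y≡0⇒y≡0 ¬z (begin
    (1# + 1#) * ((2 ^ m) ×′ 1#)         ≡⟨ cong (λ z → (1# + z) * ((2 ^ m) ×′ 1#)) (+-identityʳ 1#) ⟨
    (2 ×′ 1#) * ((2 ^ m) ×′ 1#)         ≡⟨ ×1-homo-* 2 (2 ^ m) ⟨
    (2 ^ suc m) ×′ 1#                   ≡⟨ e ⟩
    0#                                  ∎))

-- Algebra in characteristic 2.

module Char2 {q : ℕ} (F : GF q) (1+1≡0 : GF._+_ F (GF.1# F) (GF.1# F) ≡ GF.0# F) where

  open FiniteField F public

  private
    ⟦_⟧₂ : Bool → Carrier
    ⟦ true ⟧₂  = 1#
    ⟦ false ⟧₂ = 0#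

    import Algebra.Solver.Ring.AlmostCommutativeRing as ACR

    acr : ACR.AlmostCommutativeRing _ _
    acr = ACR.fromCommutativeSemiring (record { isCommutativeSemiring = isCommutativeSemiring })

    -- Taking solver coefficients in F₂, that is `Bool` with xor and conjunction, makes the normal
    -- form of x + x vanish. Negation in `acr` is the identity, so all differences are written as
    -- sums and `neg` removes the remaining signs.
    F₂ : RawRing _ _
    F₂ = CommutativeRing.rawRing xor-∧-commutativeRing

    F₂⟶F : F₂ ACR.-Raw-AlmostCommutative⟶ acr
    F₂⟶F = record
      { ⟦_⟧ = ⟦_⟧₂
      ; +-homo = λ { true true → sym 1+1≡0 ; true false → sym (+-identityʳ 1#)
                   ; false true → sym (+-identityˡ 1#) ; false false → sym (+-identityʳ 0#) }
      ; *-homo = λ { true y → sym (*-identityˡ ⟦ y ⟧₂) ; false y → sym (zeroˡ ⟦ y ⟧₂) }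
      ; -‿homo = λ _ → refl
      ; 0-homo = refl
      ; 1-homo = refl
      }

    _coeff≟_ : ∀ x y → Maybe (⟦ x ⟧₂ ≡ ⟦ y ⟧₂)
    true  coeff≟ true  = just refl
    false coeff≟ false = just refl
    _     coeff≟ _     = nothing

  open import Algebra.Solver.Ring F₂ acr F₂⟶F _coeff≟_ public
    using (solve; _:=_; _:+_; _:*_; con; Polynomial)

  :0 :1 : ∀ {n} → Polynomial n
  :0 = con false
  :1 = con true

  x+x≡0 : ∀ x → x + x ≡ 0#
  x+x≡0 x = solve 1 (λ x → x :+ x := :0) refl x

  x+y≡0⇒x≡y : ∀ {x y} → x + y ≡ 0# → x ≡ y
  x+y≡0⇒x≡y {x} {y} e = trans (solve 2 (λ x y → x := (x :+ y) :+ y) refl x y)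
                              (trans (cong (_+ y) e) (+-identityˡ y))

  neg : ∀ x → - x ≡ x
  neg x = x+y≡0⇒x≡y (-‿inverseˡ x)

  -- In characteristic 2 an equation follows from others when the sum of its two sides is a
  -- linear combination of the corresponding sums.
  lin₁ : ∀ {a b l r} c → l ≡ r → a + b ≡ c * (l + r) → a ≡ b
  lin₁ {l = l} c refl e = x+y≡0⇒x≡y (trans e (solve 2 (λ c l → c :* (l :+ l) := :0) refl c l))

  lin₂ : ∀ {a b l r l′ r′} c c′ → l ≡ r → l′ ≡ r′ → a + b ≡ c * (l + r) + c′ * (l′ + r′) → a ≡ b
  lin₂ {l = l} {l′ = l′} c c′ refl refl e = x+y≡0⇒x≡y (trans e
    (solve 4 (λ c l c′ l′ → c :* (l :+ l) :+ c′ :* (l′ :+ l′) := :0) refl c l c′ l′))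

  lin₃ : ∀ {a b l r l′ r′ l″ r″} c c′ c″ → l ≡ r → l′ ≡ r′ → l″ ≡ r″ →
         a + b ≡ c * (l + r) + c′ * (l′ + r′) + c″ * (l″ + r″) → a ≡ b
  lin₃ {l = l} {l′ = l′} {l″ = l″} c c′ c″ refl refl refl e = x+y≡0⇒x≡y (trans e
    (solve 6 (λ c l c′ l′ c″ l″ →
                c :* (l :+ l) :+ c′ :* (l′ :+ l′) :+ c″ :* (l″ :+ l″) := :0)
           refl c l c′ l′ c″ l″))

  +-nonzero : ∀ {x y} → ¬ (x ≡ y) → ¬ (x + y ≡ 0#)
  +-nonzero x≢y e = x≢y (x+y≡0⇒x≡y e)

  *-nonzero : ∀ {x y} → ¬ (x ≡ 0#) → ¬ (y ≡ 0#) → ¬ (x * y ≡ 0#)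
  *-nonzero x≢0 y≢0 e = y≢0 (x*y≡0⇒y≡0 x≢0 e)

  inverse-nonzero : ∀ {x y} → x * y ≡ 1# → ¬ (y ≡ 0#)
  inverse-nonzero {x} e refl = 0≢1 (trans (sym (zeroʳ x)) e)

-- Spans, proportionality and independence of vectors.

module Vectors {q : ℕ} (F : GF q) (1+1≡0 : GF._+_ F (GF.1# F) (GF.1# F) ≡ GF.0# F) where

  open Char2 F 1+1≡0 public
  open Geometry F public
    renaming (_⊕_ to infixl 6 _⊕_; _·_ to infixr 7 _·_; _≋_ to infix 4 _≋_; _⊖_ to infixl 6 _⊖_)

  abstract
    _≋?_ : ∀ {n} (v w : Vect n) → Dec (v ≋ w)
    v ≋? w = Fin.all? (λ i → v i ≟ w i)

  ≋-sym : ∀ {n} {v w : Vect n} → v ≋ w → w ≋ v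
  ≋-sym h i = sym (h i)

  ≋-trans : ∀ {n} {u v w : Vect n} → u ≋ v → v ≋ w → u ≋ w
  ≋-trans h k i = trans (h i) (k i)

  abstract
    Proportional? : ∀ {n} (v w : Vect n) → Dec (Proportional v w)
    Proportional? v w = ∃? (λ c → ¬? (c ≟ 0#) ×-dec (v ≋? (c · w)))

  abstract
    OnLine? : ∀ {n} (a b v : Vect n) → Dec (OnLine a b v)
    OnLine? a b v = ∃? (λ x → ∃? (λ y → v ≋? ((x · a) ⊕ (y · b))))

  prop-sym : ∀ {n} {v w : Vect n} → Proportional v w → Proportional w v
  prop-sym {v = v} {w} (c , c≢0 , h) = let c⁻¹ , cc⁻¹ = inverse c c≢0 in
    c⁻¹ , inverse-nonzero cc⁻¹ , λ i → lin₂ c⁻¹ (w i) (h i) cc⁻¹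
      (solve 4 (λ w v c d → w :+ d :* v := d :* (v :+ c :* w) :+ w :* (c :* d :+ :1))
             refl (w i) (v i) c c⁻¹)

  prop-trans : ∀ {n} {u v w : Vect n} → Proportional u v → Proportional v w → Proportional u w
  prop-trans {u = u} {v} {w} (c , c≢0 , h) (d , d≢0 , k) = c * d , *-nonzero c≢0 d≢0 , λ i →
    lin₂ 1# c (h i) (k i)
      (solve 5 (λ u v w c d → u :+ c :* d :* w := :1 :* (u :+ c :* v) :+ c :* (v :+ d :* w))
             refl (u i) (v i) (w i) c d)

  prop-resp : ∀ {n} {v v′ w : Vect n} → v′ ≋ v → Proportional v w → Proportional v′ w
  prop-resp e (c , c≢0 , h) = c , c≢0 , ≋-trans e h

  onLine-prop : ∀ {n} {a b v w : Vect n} → Proportional w v → OnLine a b v → OnLine a b w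
  onLine-prop {a = a} {b} {v} {w} (c , _ , h) (x , y , k) = c * x , c * y , λ i →
    lin₂ 1# c (h i) (k i)
      (solve 7 (λ a b v w c x y → w :+ (c :* x :* a :+ c :* y :* b) :=
                  :1 :* (w :+ c :* v) :+ c :* (v :+ (x :* a :+ y :* b)))
             refl (a i) (b i) (v i) (w i) c x y)

  -- Every change of generators goes through this closure property; sums, multiples and swapped
  -- generators below are instances of it.
  onLine-trans : ∀ {n} {a b a′ b′ v : Vect n} → OnLine a′ b′ a → OnLine a′ b′ b →
                 OnLine a b v → OnLine a′ b′ v
  onLine-trans {a = a} {b} {a′} {b′} {v} (x , y , h) (x′ , y′ , h′) (s , t , k) =
    s * x + t * x′ , s * y + t * y′ , λ i → lin₃ 1# s t (k i) (h i) (h′ i)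
      (solve 11 (λ a b a′ b′ v x y x′ y′ s t →
          v :+ ((s :* x :+ t :* x′) :* a′ :+ (s :* y :+ t :* y′) :* b′) :=
          :1 :* (v :+ (s :* a :+ t :* b)) :+ s :* (a :+ (x :* a′ :+ y :* b′))
            :+ t :* (b :+ (x′ :* a′ :+ y′ :* b′)))
        refl (a i) (b i) (a′ i) (b′ i) (v i) x y x′ y′ s t)

  onLine-∋₁ : ∀ {n} (a b : Vect n) → OnLine a b a
  onLine-∋₁ a b = 1# , 0# , λ i →
    solve 2 (λ a b → a := :1 :* a :+ :0 :* b) refl (a i) (b i)

  onLine-∋₂ : ∀ {n} (a b : Vect n) → OnLine a b b
  onLine-∋₂ a b = 0# , 1# , λ i →
    solve 2 (λ a b → b := :0 :* a :+ :1 :* b) refl (a i) (b i)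

  onLine-⊕ : ∀ {n} {a b v w : Vect n} → OnLine a b v → OnLine a b w → OnLine a b (v ⊕ w)
  onLine-⊕ {v = v} {w} p r = onLine-trans p r
    (1# , 1# , λ i → solve 2 (λ v w → v :+ w := :1 :* v :+ :1 :* w) refl (v i) (w i))

  onLine-· : ∀ {n} {a b v : Vect n} c → OnLine a b v → OnLine a b (c · v)
  onLine-· {v = v} c p = onLine-trans p p
    (c , 0# , λ i → solve 2 (λ c v → c :* v := c :* v :+ :0 :* v) refl c (v i))

  onLine-resp : ∀ {n} {a b v w : Vect n} → w ≋ v → OnLine a b v → OnLine a b w
  onLine-resp e (x , y , h) = x , y , ≋-trans e h

  onLine-swap : ∀ {n} {a b v : Vect n} → OnLine a b v → OnLine b a v
  onLine-swap {a = a} {b} = onLine-trans (onLine-∋₂ b a) (onLine-∋₁ b a)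

  multiple-on₁ : ∀ {n} {a b v : Vect n} s → v ≋ s · a → OnLine a b v
  multiple-on₁ {a = a} {b} s h = onLine-resp h (onLine-· s (onLine-∋₁ a b))

  nonzero-coeff : ∀ {n} {v w : Vect n} {c} → v ≋ c · w → NonZeroV v → ¬ (c ≡ 0#)
  nonzero-coeff {w = w} h v≢0 refl = v≢0 (λ i → trans (h i) (zeroˡ (w i)))

  ·-zero : ∀ {n} {v : Vect n} {c} → ¬ (c ≡ 0#) → (c · v) ≋ zeroV → v ≋ zeroV
  ·-zero c≢0 h i = x*y≡0⇒y≡0 c≢0 (h i)

  ·-cancelʳ : ∀ {n} {v : Vect n} {c d} → NonZeroV v → c · v ≋ d · v → c ≡ d
  ·-cancelʳ {v = v} {c} {d} v≢0 h with c ≟ d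
  ... | yes e = e
  ... | no ¬e = contradiction (·-zero (+-nonzero ¬e) λ i → lin₁ 1# (h i)
      (solve 3 (λ c d v → (c :+ d) :* v :+ :0 := :1 :* (c :* v :+ d :* v))
             refl c d (v i))) v≢0

  indep-swap : ∀ {n} {a b : Vect n} → Independent a b → Independent b a
  indep-swap ind x y h =
    let p , r = ind y x (λ i → trans (+-comm _ _) (h i)) in r , p

  indep : ∀ {n} {r d : Vect n} → NonZeroV d → ¬ (∃ λ s → r ≋ s · d) → Independent r d
  indep {r = r} {d} d≢0 ¬p x y h with x ≟ 0#
  ... | no x≢0 = contradiction
    (let x⁻¹ , e = inverse x x≢0 in x⁻¹ * y , λ i → lin₂ x⁻¹ (r i) (h i) e
      (solve 5 (λ r d x y z → r :+ z :* y :* d :=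
         z :* ((x :* r :+ y :* d) :+ :0) :+ r :* (x :* z :+ :1))
        refl (r i) (d i) x y x⁻¹)) ¬p
  ... | yes refl with y ≟ 0#
  ... | yes y≡0 = refl , y≡0
  ... | no y≢0 = contradiction (·-zero y≢0 λ i → lin₁ 1# (h i)
          (solve 3 (λ r d y → y :* d :+ :0 := :1 :* ((:0 :* r :+ y :* d) :+ :0)) refl (r i) (d i) y)) d≢0

  indep-unique : ∀ {n} {a b : Vect n} {x y x′ y′} → Independent a b →
                 x · a ⊕ y · b ≋ x′ · a ⊕ y′ · b → x ≡ x′ × y ≡ y′
  indep-unique {a = a} {b} {x} {y} {x′} {y′} ind h =
    let p , r = ind (x + x′) (y + y′) (λ i → lin₁ 1# (h i)
          (solve 6 (λ a b x y x′ y′ → ((x :+ x′) :* a :+ (y :+ y′) :* b) :+ :0 :=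
             :1 :* ((x :* a :+ y :* b) :+ (x′ :* a :+ y′ :* b)))
            refl (a i) (b i) x y x′ y′))
    in x+y≡0⇒x≡y p , x+y≡0⇒x≡y r

  -- Adding a vector of ⟨a, b⟩ keeps `z` outside that span, so the sum cannot be a multiple of `b`.
  off-plane-indep : ∀ {n} {a b z w : Vect n} → NonZeroV b → ¬ OnLine a b z → OnLine a b w →
                    Independent (z ⊕ w) b
  off-plane-indep {a = a} {b} {z} {w} b≢0 off on = indep b≢0 λ (s , h) →
    off (onLine-resp (λ i → lin₁ 1# (h i)
           (solve 3 (λ z w e → z :+ (e :+ w) := :1 :* ((z :+ w) :+ e)) refl (z i) (w i) (s * b i)))
         (onLine-⊕ (onLine-· s (onLine-∋₂ a b)) on))

-- Directions at infinity and the number of them on a line.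

module Translation {q n M : ℕ} (F : GF q) (1+1≡0 : GF._+_ F (GF.1# F) (GF.1# F) ≡ GF.0# F)
  (Q : Fin (suc M) → Geometry.Vect F n)
  (Q-injective : ∀ i j → Geometry._≋_ F (Q i) (Q j) → i ≡ j)
  (size : Geometry.HasSize F (Geometry.Directions F Q) M)
  (lines : Geometry.LineCondition F (Geometry.Directions F Q))
  (16≤q : 16 ≤ q) (q≤M : q ≤ M) where

  open Vectors F 1+1≡0 public

  -- `Directions` with the leading coordinate, always 0, dropped and the minus sign replaced by
  -- plus. Injectivity of `Q` allows distinct indices in place of distinct vectors.
  D : Vect n → Set
  D v = ∃ λ i → ∃ λ j → ¬ (i ≡ j) × Proportional v (Q i ⊕ Q j)

  abstract
    D? : ∀ v → Dec (D v)
    D? v = Fin.any? λ i → Fin.any? λ j → ¬? (i Fin.≟ j) ×-dec Proportional? v (Q i ⊕ Q j)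

  D-prop : ∀ {v w} → Proportional w v → D v → D w
  D-prop p (i , j , i≢j , p′) = i , j , i≢j , prop-trans p p′

  D-resp : ∀ {v w} → w ≋ v → D v → D w
  D-resp e (i , j , i≢j , p′) = i , j , i≢j , prop-resp e p′

  D-nonzero : ∀ {v} → D v → NonZeroV v
  D-nonzero (i , j , i≢j , c , c≢0 , h) v≡0 =
    i≢j (Q-injective i j λ x → x+y≡0⇒x≡y (·-zero c≢0 (≋-trans (≋-sym h) v≡0) x))

  D-join : ∀ {i j c v} → ¬ (i ≡ j) → Q j ≋ Q i ⊕ c · v → D v
  D-join {i} {j} {c} {v} i≢j h with c ≟ 0#
  ... | yes refl = contradiction (Q-injective i j λ x → lin₁ 1# (h x)
          (solve 3 (λ a b v → a :+ b := :1 :* (b :+ (a :+ :0 :* v))) refl (Q i x) (Q j x) (v x))) i≢j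
  ... | no c≢0 = let c⁻¹ , e = inverse c c≢0 in
    i , j , i≢j , c⁻¹ , inverse-nonzero e , λ x → lin₂ c⁻¹ (v x) (h x) e
      (solve 5 (λ a b v c d → v :+ d :* (a :+ b) := d :* (b :+ (a :+ c :* v)) :+ v :* (c :* d :+ :1))
             refl (Q i x) (Q j x) (v x) c c⁻¹)

  ∞-head : ∀ {w} → Geometry.Directions F Q w → w zero ≡ 0#
  ∞-head (i , j , _ , c , _ , h) = trans (h zero) (trans (cong (c *_) (-‿inverseʳ 1#)) (zeroʳ c))

  ∞-tail : ∀ {w : Vect (suc n)} → w zero ≡ 0# → w ≋ atInfinity (λ x → w (suc x))
  ∞-tail e zero    = e
  ∞-tail e (suc x) = refl

  dir⇒D : ∀ {w} → Geometry.Directions F Q w → D (λ x → w (suc x))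
  dir⇒D (i , j , ne , c , c≢0 , h) =
    i , j , (λ { refl → ne (λ _ → refl) }) , c , c≢0 ,
    λ x → trans (h (suc x)) (cong (λ z → c * (Q i x + z)) (neg (Q j x)))

  D⇒dir : ∀ {v} → D v → Geometry.Directions F Q (atInfinity v)
  D⇒dir (i , j , i≢j , c , c≢0 , h) = i , j , (λ e → i≢j (Q-injective i j e)) , c , c≢0 , λ
    { zero    → sym (trans (cong (c *_) (-‿inverseʳ 1#)) (zeroʳ c))
    ; (suc x) → trans (h x) (cong (λ z → c * (Q i x + z)) (sym (neg (Q j x)))) }

  ∞-prop : ∀ {v w : Vect n} → Proportional v w → Proportional (atInfinity v) (atInfinity w)
  ∞-prop (c , c≢0 , h) = c , c≢0 , λ { zero → sym (zeroʳ c) ; (suc x) → h x }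

  prop-tail : ∀ {v w : Vect (suc n)} → Proportional v w →
              Proportional (λ x → v (suc x)) (λ x → w (suc x))
  prop-tail (c , c≢0 , h) = c , c≢0 , λ x → h (suc x)

  dir-prop : ∀ {v w : Vect (suc n)} → v zero ≡ 0# → w zero ≡ 0# →
             Proportional (λ x → v (suc x)) (λ x → w (suc x)) → Proportional v w
  dir-prop {v} {w} e e′ p = prop-resp (∞-tail {v} e) (prop-trans (∞-prop p)
    (1# , (λ z → 0≢1 (sym z)) , λ x → trans (sym (∞-tail {w} e′ x)) (sym (*-identityˡ _))))

  private
    L̂ : Fin M → Vect (suc n)
    L̂ = proj₁ size

    L̂-dir : ∀ e → Geometry.Directions F Q (L̂ e)
    L̂-dir e = proj₂ (proj₁ (proj₂ size) e)

  L : Fin M → Vect n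
  L e x = L̂ e (suc x)

  L∈D : ∀ e → D (L e)
  L∈D e = dir⇒D (L̂-dir e)

  L-injective : ∀ {e e′} → Proportional (L e) (L e′) → e ≡ e′
  L-injective {e} {e′} p =
    proj₁ (proj₂ (proj₂ size)) e e′ (dir-prop (∞-head (L̂-dir e)) (∞-head (L̂-dir e′)) p)

  ∞-nonzero : ∀ {v : Vect n} → NonZeroV v → NonZeroV (atInfinity v)
  ∞-nonzero v≢0 h = v≢0 (λ x → h (suc x))

  abstract
    L-cover : ∀ {v} → D v → ∃ λ e → Proportional v (L e)
    L-cover {v} d =
      let e , p = proj₂ (proj₂ (proj₂ size)) (atInfinity v) (∞-nonzero (D-nonzero d)) (D⇒dir d)
      in e , prop-tail p

  ∞-indep : ∀ {a b : Vect n} → Independent a b → Independent (atInfinity a) (atInfinity b)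
  ∞-indep ind x y h = ind x y (λ i → h (suc i))

  ∞-onLine : ∀ {a b v : Vect n} → OnLine a b v → OnLine (atInfinity a) (atInfinity b) (atInfinity v)
  ∞-onLine (x , y , h) = x , y , λ
    { zero → solve 2 (λ x y → :0 := x :* :0 :+ y :* :0) refl x y ; (suc i) → h i }

  onLine-tail : ∀ {a b : Vect n} {w} → OnLine (atInfinity a) (atInfinity b) w →
                OnLine a b (λ i → w (suc i))
  onLine-tail (x , y , h) = x , y , λ i → h (suc i)

  ℓ : Vect n → Vect n → ℕ
  ℓ a b = ♯ (λ e → OnLine? a b (L e))

  ℓ-mono : ∀ {a b a′ b′} → OnLine a′ b′ a → OnLine a′ b′ b → ℓ a b ≤ ℓ a′ b′
  ℓ-mono {a} {b} {a′} {b′} p r =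
    ♯-mono (λ e → OnLine? a b (L e)) (λ e → OnLine? a′ b′ (L e)) (λ e → onLine-trans p r)

  LineSize : ℕ → Set
  LineSize t = t ≡ 0 ⊎ t ≡ 1 ⊎ t ≡ 3 ⊎ t ≡ q ∸ 1

  -- The line condition lists points in homogeneous coordinates, whereas `ℓ` counts indices into
  -- `L`. Each list covers the other without repetition up to proportionality, so the two numbers
  -- agree.
  ℓ-size : ∀ {a b} → Independent a b → LineSize (ℓ a b)
  ℓ-size {a} {b} ind with lines (atInfinity a) (atInfinity b) (∞-indep ind)
  ... | t , t∈ , L′ , L′∈ , L′-inj , L′-cover = subst LineSize (ℕₚ.≤-antisym t≤ℓ ℓ≤t) t∈
    where
    S? : ∀ e → Dec (OnLine a b (L e))
    S? e = OnLine? a b (L e)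

    dir′ : ∀ s → Geometry.Directions F Q (L′ s)
    dir′ s = proj₁ (proj₂ (L′∈ s))

    idx : ∀ s → ∃ λ e → Proportional (λ x → L′ s (suc x)) (L e)
    idx s = L-cover (dir⇒D (dir′ s))

    t≤ℓ : t ≤ ℓ a b
    t≤ℓ = ℕₚ.≤-trans (♯-full {t} ⊤? _) (♯-injection ⊤? S? (λ s _ → proj₁ (idx s))
      (λ s _ → onLine-prop (prop-sym (proj₂ (idx s))) (onLine-tail (proj₂ (proj₂ (L′∈ s)))))
      (λ s s′ _ _ e → L′-inj s s′ (dir-prop (∞-head (dir′ s)) (∞-head (dir′ s′))
        (prop-trans (proj₂ (idx s)) (prop-sym
          (subst (λ z → Proportional (λ x → L′ s′ (suc x)) (L z)) (sym e) (proj₂ (idx s′))))))))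

    idx′ : ∀ e → OnLine a b (L e) → ∃ λ s → Proportional (atInfinity (L e)) (L′ s)
    idx′ e on = L′-cover (atInfinity (L e)) (∞-nonzero (D-nonzero (L∈D e)))
                         (D⇒dir (L∈D e) , ∞-onLine on)

    ℓ≤t : ℓ a b ≤ t
    ℓ≤t = ℕₚ.≤-trans (♯-injection S? (⊤? {t}) (λ e on → proj₁ (idx′ e on)) _
      (λ e e′ on on′ eq → L-injective (prop-tail (prop-trans (proj₂ (idx′ e on)) (prop-sym
          (subst (λ z → Proportional (atInfinity (L e′)) (L′ z)) (sym eq) (proj₂ (idx′ e′ on′))))))))
      (♯≤n (⊤? {t}))

  -- The number of directions on the line ⟨a, b⟩ apart from ⟨b⟩.
  cnt : Vect n → Vect n → ℕ
  cnt a b = ♯ (λ l → D? (a ⊕ el l · b))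

  module _ {a b : Vect n} (ind : Independent a b) where

    on-shift : ∀ x → OnLine a b (a ⊕ x · b)
    on-shift x = onLine-⊕ (onLine-∋₁ a b) (onLine-· x (onLine-∋₂ a b))

    shift≁b : ∀ x → ¬ Proportional (a ⊕ x · b) b
    shift≁b x (c , _ , h) = 0≢1 (sym (proj₁ (ind 1# (x + c) λ i → lin₁ 1# (h i)
      (solve 4 (λ a b x c → (:1 :* a :+ (x :+ c) :* b) :+ :0 := :1 :* ((a :+ x :* b) :+ c :* b))
        refl (a i) (b i) x c))))

    shift-injective : ∀ {x y} → Proportional (a ⊕ x · b) (a ⊕ y · b) → x ≡ y
    shift-injective {x} {y} (c , _ , h) =
      let c≡1 , x≡cy = indep-unique {x = 1#} {x} {c} {c * y} ind λ i → lin₁ 1# (h i)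
            (solve 5 (λ a b x y c → (:1 :* a :+ x :* b) :+ (c :* a :+ c :* y :* b) :=
               :1 :* ((a :+ x :* b) :+ c :* (a :+ y :* b))) refl (a i) (b i) x y c)
      in trans x≡cy (trans (cong (_* y) (sym c≡1)) (*-identityˡ y))

    private
      On? : ∀ e → Dec (OnLine a b (L e))
      On? e = OnLine? a b (L e)

      ~b? : ∀ e → Dec (Proportional (L e) b)
      ~b? e = Proportional? (L e) b

      Off? : ∀ e → Dec (OnLine a b (L e) × ¬ Proportional (L e) b)
      Off? e = On? e ×-dec ¬? (~b? e)

      -- A point of the line other than ⟨b⟩ has a nonzero coefficient at `a`, which can be scaled to
      -- 1.
      normalise : ∀ e → OnLine a b (L e) × ¬ Proportional (L e) b →
                  ∃ λ l → Proportional (L e) (a ⊕ el l · b)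
      normalise e ((x , y , h) , ≁b) with x ≟ 0#
      ... | yes refl = contradiction (y , nonzero-coeff Le≡yb (D-nonzero (L∈D e)) , Le≡yb) ≁b
        where
        Le≡yb : L e ≋ y · b
        Le≡yb i = trans (h i) (solve 3 (λ a b y → :0 :* a :+ y :* b := y :* b) refl (a i) (b i) y)
      ... | no x≢0 = let x⁻¹ , xx⁻¹ = inverse x x≢0 in
        ix (x⁻¹ * y) , x , x≢0 , λ i → lin₃ 1# (x * b i) (y * b i) (h i) (el-ix (x⁻¹ * y)) xx⁻¹
          (solve 7 (λ v a b x y z l → v :+ x :* (a :+ l :* b) :=
             :1 :* (v :+ (x :* a :+ y :* b)) :+ x :* b :* (l :+ z :* y) :+ y :* b :* (x :* z :+ :1))
            refl (L e i) (a i) (b i) x y x⁻¹ (el (ix (x⁻¹ * y))))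

      Off≤cnt : ♯ Off? ≤ cnt a b
      Off≤cnt = ♯-injection Off? (λ l → D? (a ⊕ el l · b)) (λ e on → proj₁ (normalise e on))
        (λ e on → D-prop (prop-sym (proj₂ (normalise e on))) (L∈D e))
        (λ e e′ on on′ eq → L-injective (prop-trans (proj₂ (normalise e on)) (prop-sym
          (subst (λ z → Proportional (L e′) (a ⊕ el z · b)) (sym eq) (proj₂ (normalise e′ on′))))))

      cnt≤Off : cnt a b ≤ ♯ Off?
      cnt≤Off = ♯-injection (λ l → D? (a ⊕ el l · b)) Off? (λ l d → proj₁ (L-cover d))
        (λ l d → onLine-prop (prop-sym (proj₂ (L-cover d))) (on-shift (el l)) ,
                 λ p → shift≁b (el l) (prop-trans (proj₂ (L-cover d)) p))
        (λ l l′ d d′ eq → el-injective (shift-injective (prop-trans (proj₂ (L-cover d)) (prop-sym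
          (subst (λ z → Proportional (a ⊕ el l′ · b) (L z)) (sym eq) (proj₂ (L-cover d′)))))))

      split : ∀ e → OnLine a b (L e) → Proportional (L e) b ⊎ (OnLine a b (L e) × ¬ Proportional (L e) b)
      split e on with ~b? e
      ... | yes p = inj₁ p
      ... | no ¬p = inj₂ (on , ¬p)

      ℓ≤ : ℓ a b ≤ ♯ ~b? ℕ.+ cnt a b
      ℓ≤ = ℕₚ.≤-trans (♯-∪ On? ~b? Off? split) (ℕₚ.+-monoʳ-≤ (♯ ~b?) Off≤cnt)

    cnt-∉ : ¬ D b → cnt a b ≡ ℓ a b
    cnt-∉ b∉D = ℕₚ.≤-antisym
      (ℕₚ.≤-trans cnt≤Off (♯-mono Off? On? (λ _ → proj₁)))
      (ℕₚ.≤-trans ℓ≤ (ℕₚ.≤-reflexive (cong (ℕ._+ cnt a b)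
        (♯-∅ ~b? (λ e p → b∉D (D-prop (prop-sym p) (L∈D e)))))))

    cnt-∈ : D b → suc (cnt a b) ≡ ℓ a b
    cnt-∈ b∈D = ℕₚ.≤-antisym
      (ℕₚ.≤-trans (ℕₚ.+-mono-≤ (♯-∋ ~b? (proj₁ (L-cover b∈D)) (prop-sym (proj₂ (L-cover b∈D)))) cnt≤Off)
        (♯-⊎ On? ~b? Off? (λ e p → onLine-prop p (onLine-∋₂ a b)) (λ _ → proj₁) (λ _ p o → proj₂ o p)))
      (ℕₚ.≤-trans ℓ≤ (ℕₚ.+-monoˡ-≤ (cnt a b)
        (♯-subsingleton ~b? (λ e e′ p p′ → L-injective (prop-trans p (prop-sym p′))))))

  -- Red lines and points outside D.

  Red : Vect n → Vect n → Set
  Red a b = suc (ℓ a b) ≡ q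

  suc[q∸1] : suc (q ∸ 1) ≡ q
  suc[q∸1] = trans (sym (ℕₚ.+-∸-assoc 1 (ℕₚ.≤-trans (s≤s z≤n) 16≤q))) refl

  -- Among the admissible sizes 0, 1, 3 and q - 1, only the last can reach 4.
  4≤size⇒red : ∀ {t} → LineSize t → 4 ≤ t → suc t ≡ q
  4≤size⇒red (inj₁ refl) ()
  4≤size⇒red (inj₂ (inj₁ refl)) (s≤s ())
  4≤size⇒red (inj₂ (inj₂ (inj₁ refl))) (s≤s (s≤s (s≤s ())))
  4≤size⇒red (inj₂ (inj₂ (inj₂ refl))) _ = suc[q∸1]

  4≤⇒red : ∀ {a b} → Independent a b → 4 ≤ ℓ a b → Red a b
  4≤⇒red ind = 4≤size⇒red (ℓ-size ind)

  size<q : ∀ {t} → LineSize t → t < q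
  size<q (inj₁ refl) = ℕₚ.≤-trans (ℕₚ.m≤m+n 1 15) 16≤q
  size<q (inj₂ (inj₁ refl)) = ℕₚ.≤-trans (ℕₚ.m≤m+n 2 14) 16≤q
  size<q (inj₂ (inj₂ (inj₁ refl))) = ℕₚ.≤-trans (ℕₚ.m≤m+n 4 12) 16≤q
  size<q (inj₂ (inj₂ (inj₂ refl))) = ℕₚ.≤-reflexive suc[q∸1]

  ℓ<q : ∀ {a b} → Independent a b → ℓ a b < q
  ℓ<q ind = size<q (ℓ-size ind)

  cnt-list : ∀ {a b} xs → Unique xs → All (λ x → D (a ⊕ x · b)) xs →
             length xs ≤ cnt a b
  cnt-list {a} {b} xs u ds = subst (_≤ cnt a b) (List.length-map ix xs)
    (unique⇒♯≥ (λ l → D? (a ⊕ el l · b)) (List.map ix xs)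
      (Unique.map⁺ ix-injective u)
      (All.map⁺ (All.map (λ {x} → subst (λ z → D (a ⊕ z · b)) (sym (el-ix x))) ds)))

  D-diff : ∀ {i j v} → ¬ (i ≡ j) → v ≋ Q i ⊕ Q j → D v
  D-diff {i} {j} ne h = i , j , ne , 1# , (λ e → 0≢1 (sym e)) , λ x → trans (h x) (sym (*-identityˡ _))

  abstract
    -- The line has fewer than q directions, and one of them is ⟨d⟩, so the q points v + xd cannot
    -- all lie in D. This supplies the points along which Q is projected.
    hole : ∀ {v d} → D d → Independent v d → ∃ λ x → ¬ D (v ⊕ x · d)
    hole {v} {d} d∈D ind =
      let l , _ , ¬p = ♯-witness-∖ (λ l → D? (v ⊕ el l · d)) ⊤?
            (ℕₚ.<-≤-trans (ℕₚ.<-trans (ℕₚ.≤-reflexive (cnt-∈ ind d∈D)) (ℓ<q ind)) (♯-full ⊤? _))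
      in el l , ¬p

  -- Points of Q in a plane, and the absence of collinear triples.

  InPlane? : ∀ i a b m → Dec (OnLine a b (Q m ⊕ Q i))
  InPlane? i a b m = OnLine? a b (Q m ⊕ Q i)

  -- Two points of Q in the plane with the same `d`-coordinate differ by a multiple of `h`, which
  -- would put `h` into D.
  plane-bound-∉ : ∀ {i d h} → ¬ D h → ♯ (InPlane? i d h) ≤ q
  plane-bound-∉ {i} {d} {h} h∉D = ℕₚ.≤-trans
    (♯-injection (InPlane? i d h) ⊤? (λ m p → ix (proj₁ p)) _
      (λ m m′ p p′ e → same-coordinate (ix-injective e) (proj₂ (proj₂ p)) (proj₂ (proj₂ p′))))
    (♯≤n (⊤? {q}))
    where
    same-coordinate : ∀ {m m′ x y x′ y′} → x ≡ x′ → Q m ⊕ Q i ≋ x · d ⊕ y · h →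
                      Q m′ ⊕ Q i ≋ x′ · d ⊕ y′ · h → m ≡ m′
    same-coordinate {m} {m′} {x} {y} {y′ = y′} refl k k′ with m Fin.≟ m′
    ... | yes eq = eq
    ... | no ne = contradiction (D-join {c = y′ + y} ne (λ z → lin₂ 1# 1# (k z) (k′ z)
            (solve 8 (λ a b c d h x y y′ → b :+ (a :+ (y′ :+ y) :* h) :=
               :1 :* ((a :+ c) :+ (x :* d :+ y :* h)) :+ :1 :* ((b :+ c) :+ (x :* d :+ y′ :* h))) refl
              (Q m z) (Q m′ z) (Q i z) (d z) (h z) x y y′))) h∉D

  -- Replacing `v` by a point v + xd outside D leaves the plane unchanged.
  plane-bound : ∀ {i v d} → D d → Independent v d → ♯ (InPlane? i d v) ≤ q
  plane-bound {i} {v} {d} d∈D ind =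
    let x , h∉D = hole d∈D ind in
    ℕₚ.≤-trans (♯-mono (InPlane? i d v) (InPlane? i d (v ⊕ x · d))
                  (λ m → onLine-trans (onLine-∋₁ d _) (x , 1# , λ z →
                    solve 3 (λ d v x → v := x :* d :+ :1 :* (v :+ x :* d)) refl (d z) (v z) x)))
               (plane-bound-∉ h∉D)

  abstract
    off-line : ∀ i {d} → NonZeroV d → ∃ λ m → Independent (Q m ⊕ Q i) d
    off-line i {d} d≢0 = proj₁ off , indep d≢0 (proj₂ (proj₂ off))
      where
      OnRay? : ∀ m → Dec (∃ λ s → Q m ⊕ Q i ≋ s · d)
      OnRay? m = ∃? (λ s → (Q m ⊕ Q i) ≋? (s · d))

      same : ∀ {m m′ s s′} → s ≡ s′ → Q m ⊕ Q i ≋ s · d → Q m′ ⊕ Q i ≋ s′ · d → m ≡ m′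
      same {m} {m′} {s} refl h h′ = Q-injective m m′ λ x → lin₂ 1# 1# (h x) (h′ x)
        (solve 4 (λ a b c e → a :+ b := :1 :* ((a :+ c) :+ e) :+ :1 :* ((b :+ c) :+ e)) refl
          (Q m x) (Q m′ x) (Q i x) (s * d x))

      few : ♯ OnRay? ≤ q
      few = ℕₚ.≤-trans (♯-injection OnRay? ⊤? (λ m p → ix (proj₁ p)) _
              (λ m m′ p p′ e → same (ix-injective e) (proj₂ p) (proj₂ p′))) (♯≤n (⊤? {q}))

      off : ∃ λ m → ⊤ × ¬ (∃ λ s → Q m ⊕ Q i ≋ s · d)
      off = ♯-witness-∖ OnRay? ⊤? (ℕₚ.≤-trans (s≤s (ℕₚ.≤-trans few q≤M)) (♯-full ⊤? _))

  module _ {i m d} (ind : Independent (Q m ⊕ Q i) d) where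

    off-ray-≢ : ∀ p {s} → Q p ≋ Q i ⊕ s · d → ¬ (m ≡ p)
    off-ray-≢ p {s} h refl = 0≢1 (sym (proj₁ (ind 1# s λ x → lin₁ 1# (h x)
      (solve 4 (λ a b s d → (:1 :* (b :+ a) :+ s :* d) :+ :0 := :1 :* (b :+ (a :+ s :* d))) refl
        (Q i x) (Q p x) s (d x)))))

    -- Seen from `Q m`, a point of Q on the affine line through `Q i` with direction `d` yields a
    -- direction on ⟨Q m - Q i, d⟩ whose parameter is its position on that line. Several such points
    -- thus become several entries of `cnt-list`.
    off-ray-D : ∀ p {s} → Q p ≋ Q i ⊕ s · d → D ((Q m ⊕ Q i) ⊕ s · d)
    off-ray-D p {s} h = D-diff (off-ray-≢ p h) λ x → lin₁ 1# (h x)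
      (solve 4 (λ a b c e → (c :+ a :+ e) :+ (c :+ b) := :1 :* (b :+ (a :+ e))) refl
        (Q i x) (Q p x) (Q m x) (s * d x))

  -- If Qᵢ, Qⱼ, Qₖ were collinear with direction d, every line through d and another direction seen
  -- from Qᵢ would have q − 1 points in D, while its plane through Qᵢ has at most q − 3 points of Q off
  -- the line.  Counting incidences between the points outside one such plane and the directions
  -- outside its line at infinity, which are at most as many, gives a contradiction.
  module _ {i j k γ} (i≢j : ¬ (i ≡ j)) (i≢k : ¬ (i ≡ k)) (j≢k : ¬ (j ≡ k))
           (k-on : Q k ≋ Q i ⊕ γ · (Q j ⊕ Q i)) where

    private
      d : Vect n
      d = Q j ⊕ Q i

      d∈D : D d
      d∈D = D-diff (λ e → i≢j (sym e)) (λ _ → refl)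

      γ≢0 : ¬ (0# ≡ γ)
      γ≢0 refl = i≢k (Q-injective i k λ x → lin₁ 1# (k-on x)
        (solve 3 (λ a b c → a :+ c := :1 :* (c :+ (a :+ :0 :* (b :+ a)))) refl (Q i x) (Q j x) (Q k x)))

      γ≢1 : ¬ (1# ≡ γ)
      γ≢1 refl = j≢k (Q-injective j k λ x → lin₁ 1# (k-on x)
        (solve 3 (λ a b c → b :+ c := :1 :* (c :+ (a :+ :1 :* (b :+ a)))) refl (Q i x) (Q j x) (Q k x)))

      module _ {m} (ind : Independent (Q m ⊕ Q i) d) where

        red : suc (suc (cnt (Q m ⊕ Q i) d)) ≡ q
        red = trans (cong suc (cnt-∈ ind d∈D))
          (4≤⇒red ind (ℕₚ.≤-trans (s≤s three) (ℕₚ.≤-reflexive (cnt-∈ ind d∈D))))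
          where
          three : 3 ≤ cnt (Q m ⊕ Q i) d
          three = cnt-list (0# ∷ 1# ∷ γ ∷ [])
            ((0≢1 ∷ γ≢0 ∷ []) ∷ (γ≢1 ∷ []) ∷ [] ∷ [])
            (off-ray-D ind i (λ x → solve 2 (λ a d → a := a :+ :0 :* d) refl (Q i x) (d x))
            ∷ off-ray-D ind j (λ x → solve 2 (λ a b → b := a :+ :1 :* (b :+ a)) refl (Q i x) (Q j x))
            ∷ off-ray-D ind k k-on ∷ [])

      m₀ = proj₁ (off-line i (D-nonzero d∈D))
      r₀ = Q m₀ ⊕ Q i
      r₀-indep = proj₂ (off-line i (D-nonzero d∈D))

      P? : ∀ m → Dec (¬ OnLine d r₀ (Q m ⊕ Q i))
      P? m = ¬? (OnLine? d r₀ (Q m ⊕ Q i))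

      R? : ∀ e → Dec (¬ OnLine d r₀ (L e))
      R? e = ¬? (OnLine? d r₀ (L e))

      T? : ∀ m e → Dec (OnLine d (L e) (Q m ⊕ Q i))
      T? m e = OnLine? d (L e) (Q m ⊕ Q i)

      P-indep : ∀ {m} → ¬ OnLine d r₀ (Q m ⊕ Q i) → Independent (Q m ⊕ Q i) d
      P-indep off = indep (D-nonzero d∈D) (λ (s , h) → off (multiple-on₁ s h))

      R-indep : ∀ {e} → ¬ OnLine d r₀ (L e) → Independent (L e) d
      R-indep off = indep (D-nonzero d∈D) (λ (s , h) → off (multiple-on₁ s h))

      unshift : ∀ (r : Vect n) x → r ≋ (r ⊕ x · d) ⊕ x · d
      unshift r x y = solve 2 (λ r e → r := (r :+ e) :+ e) refl (r y) (x * d y)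

      unshift-on : ∀ {b r : Vect n} x → OnLine d b (r ⊕ x · d) → OnLine d b r
      unshift-on {b} {r} x p = onLine-resp (unshift r x) (onLine-⊕ p (onLine-· x (onLine-∋₁ d b)))

      row : ∀ m → ¬ OnLine d r₀ (Q m ⊕ Q i) →
            cnt (Q m ⊕ Q i) d ≤ ♯ (λ e → R? e ×-dec T? m e)
      row m off = ♯-injection (λ l → D? ((Q m ⊕ Q i) ⊕ el l · d)) (λ e → R? e ×-dec T? m e)
        (λ l p → proj₁ (L-cover p))
        (λ l p → (λ on → off (unshift-on (el l) (onLine-prop (proj₂ (L-cover p)) on))) ,
                 unshift-on (el l) (onLine-prop (proj₂ (L-cover p)) (onLine-∋₂ d _)))
        (λ l l′ p p′ eq → el-injective (shift-injective (P-indep off)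
          (prop-trans (proj₂ (L-cover p)) (prop-sym
            (subst (λ z → Proportional _ (L z)) (sym eq) (proj₂ (L-cover p′)))))))

      col : ∀ e → ¬ OnLine d r₀ (L e) → ♯ (λ m → P? m ×-dec T? m e) ℕ.+ 3 ≤ q
      col e off = ℕₚ.≤-trans
        (ℕₚ.≤-trans (ℕₚ.+-monoʳ-≤ (♯ PT?) (unique⇒♯≥ ¬PT? (i ∷ j ∷ k ∷ [])
                       ((i≢j ∷ i≢k ∷ []) ∷ (j≢k ∷ []) ∷ [] ∷ [])
                       (on i {0#} (λ x → solve 2 (λ a d → a :+ a := :0 :* d) refl (Q i x) (d x))
                       ∷ on j {1#} (λ x → solve 1 (λ d → d := :1 :* d) refl (d x))
                       ∷ on k {γ} (λ x → lin₁ 1# (k-on x)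
                           (solve 3 (λ a c d → (c :+ a) :+ d := :1 :* (c :+ (a :+ d))) refl
                              (Q i x) (Q k x) (γ * d x)))
                       ∷ [])))
                    (♯-⊎ (λ m → T? m e) PT? ¬PT? (λ _ → proj₂) (λ _ → proj₂)
                         (λ _ a b → proj₁ a (proj₁ b))))
        (plane-bound d∈D (R-indep off))
        where
        PT? = λ m → P? m ×-dec T? m e
        ¬PT? = λ m → OnLine? d r₀ (Q m ⊕ Q i) ×-dec T? m e

        on : ∀ m {s} → Q m ⊕ Q i ≋ s · d → OnLine d r₀ (Q m ⊕ Q i) × OnLine d (L e) (Q m ⊕ Q i)
        on m {s} h = multiple-on₁ s h , multiple-on₁ s h

      p = cnt r₀ d

      red₀ : suc (suc p) ≡ q
      red₀ = red r₀-indep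

      ℓ₀ : suc (ℓ d r₀) ≡ q
      ℓ₀ = trans (cong suc (trans (ℕₚ.≤-antisym (ℓ-mono (onLine-∋₂ _ _) (onLine-∋₁ _ _))
                                                (ℓ-mono (onLine-∋₂ _ _) (onLine-∋₁ _ _)))
                                  (sym (cnt-∈ r₀-indep d∈D)))) red₀

      ♯R+q : ♯ R? ℕ.+ q ≡ suc M
      ♯R+q = trans (cong (♯ R? ℕ.+_) (sym ℓ₀)) (trans (ℕₚ.+-suc _ _)
               (cong suc (trans (ℕₚ.+-comm (♯ R?) _) (♯-∁ (λ e → OnLine? d r₀ (L e))))))

      ♯P+q : suc M ≤ ♯ P? ℕ.+ q
      ♯P+q = ℕₚ.≤-trans (ℕₚ.≤-reflexive (sym (trans (ℕₚ.+-comm (♯ P?) _) (♯-∁ (InPlane? i d r₀)))))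
               (ℕₚ.+-monoʳ-≤ (♯ P?) (plane-bound d∈D r₀-indep))

      -- Removing the plane costs Q at most q of its M + 1 points, and removing its line at infinity
      -- costs D exactly q - 1 of its M directions. The two deficits match because |D| = |Q| - 1.
      ♯R≤♯P : ♯ R? ≤ ♯ P?
      ♯R≤♯P = ℕₚ.+-cancelʳ-≤ q _ _ (ℕₚ.≤-trans (ℕₚ.≤-reflexive ♯R+q) ♯P+q)

      1≤♯P : 1 ≤ ♯ P?
      1≤♯P = ℕₚ.+-cancelʳ-≤ q _ _ (ℕₚ.≤-trans (s≤s q≤M) ♯P+q)

      absurd : ∀ {a x y} → 1 ≤ x → y ≤ x → suc a ℕ.* x ≤ a ℕ.* y → ⊥
      absurd {a} {x} {y} 1≤x y≤x h = ℕₚ.<-irrefl refl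
        (ℕₚ.≤-trans (ℕₚ.+-monoˡ-≤ (a ℕ.* x) 1≤x) (ℕₚ.≤-trans h (ℕₚ.*-monoʳ-≤ a y≤x)))

      counted : ∀ {a} → suc a ≡ p → suc a ℕ.* ♯ P? ≤ a ℕ.* ♯ R?
      counted {a} e = double-count P? R? T?
        (λ m off → ℕₚ.≤-trans (ℕₚ.≤-reflexive (trans e (ℕₚ.suc-injective (ℕₚ.suc-injective
            (trans red₀ (sym (red (P-indep off)))))))) (row m off))
        (λ e′ off → ℕₚ.+-cancelʳ-≤ 3 _ _ (ℕₚ.≤-trans (col e′ off)
            (ℕₚ.≤-reflexive (trans (trans (sym red₀) (cong (λ z → suc (suc z)) (sym e))) (ℕₚ.+-comm 3 a)))))

      predecessor : ∀ {x} → 16 ≤ suc (suc x) → ∃ λ a → suc a ≡ x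
      predecessor {suc a} _ = a , refl
      predecessor {zero} (s≤s (s≤s ()))

    no-three : ⊥
    no-three = let a , e = predecessor (subst (16 ≤_) (sym red₀) 16≤q) in
      absurd {a} 1≤♯P ♯R≤♯P (counted e)

  no-three-on : ∀ {i j k c c′ v} → ¬ (i ≡ j) → ¬ (i ≡ k) →
                Q j ≋ Q i ⊕ c · v → Q k ≋ Q i ⊕ c′ · v → j ≡ k
  no-three-on {i} {j} {k} {c} {c′} {v} i≢j i≢k h h′ with j Fin.≟ k
  ... | yes e = e
  ... | no j≢k with c ≟ 0#
  ... | yes refl = contradiction (Q-injective i j λ x → lin₁ 1# (h x)
          (solve 3 (λ a b v → a :+ b := :1 :* (b :+ (a :+ :0 :* v))) refl (Q i x) (Q j x) (v x))) i≢j
  ... | no c≢0 = let c⁻¹ , e = inverse c c≢0 in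
    ⊥-elim (no-three {γ = c′ * c⁻¹} i≢j i≢k j≢k λ x → lin₃ 1# (c′ * c⁻¹) (c′ * v x) (h′ x) (h x) e
      (solve 7 (λ a b k c d z v → k :+ (a :+ d :* z :* (b :+ a)) :=
          :1 :* (k :+ (a :+ d :* v)) :+ d :* z :* (b :+ (a :+ c :* v)) :+ d :* v :* (c :* z :+ :1)) refl
        (Q i x) (Q j x) (Q k x) c c′ c⁻¹ (v x)))

  -- Visibility of directions and translation across lines that are not red.

  forward : ∀ {i j w} ((c , _) : Proportional (Q j ⊕ Q i) w) → Q j ≋ Q i ⊕ c · w
  forward {i} {j} {w} (c , _ , h) x = lin₁ 1# (h x)
    (solve 3 (λ a b w → b :+ (a :+ w) := :1 :* ((b :+ a) :+ w)) refl (Q i x) (Q j x) (c * w x))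

  abstract
    -- The M points of Q other than `Q i` lie in pairwise different directions from it, by
    -- `no-three-on`, and D has only M elements.
    see : ∀ i {v} → D v → ∃ λ j → ¬ (i ≡ j) × Proportional (Q j ⊕ Q i) v
    see i {v} v∈D =
      let e , v~Lₑ = L-cover v∈D
          j , j≢i , Qⱼ-Qᵢ~Lₑ = all-of-♯ Seen? many e
      in j , (λ i≡j → j≢i (sym i≡j)) , prop-trans Qⱼ-Qᵢ~Lₑ (prop-sym v~Lₑ)
      where
      Seen? : ∀ e → Dec (∃ λ j → ¬ (j ≡ i) × Proportional (Q j ⊕ Q i) (L e))
      Seen? e = Fin.any? (λ j → ¬? (j Fin.≟ i) ×-dec Proportional? (Q j ⊕ Q i) (L e))

      dir : ∀ {j} → ¬ (j ≡ i) → ∃ λ e → Proportional (Q j ⊕ Q i) (L e)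
      dir ne = L-cover (D-diff ne (λ _ → refl))

      many : M ≤ ♯ Seen?
      many = ℕₚ.≤-trans (ℕₚ.≤-pred (ℕₚ.≤-trans (♯-full ⊤? _) (♯-∖-≤ ⊤? i)))
        (♯-injection (⊤? ∖ i) Seen? (λ j p → proj₁ (dir (proj₂ p)))
          (λ j p → j , proj₂ p , proj₂ (dir (proj₂ p)))
          (λ j j′ p p′ eq → no-three-on (λ e → proj₂ p (sym e)) (λ e → proj₂ p′ (sym e))
            (forward (proj₂ (dir (proj₂ p))))
            (forward (subst (λ z → Proportional (Q j′ ⊕ Q i) (L z)) (sym eq) (proj₂ (dir (proj₂ p′)))))))

  red-cnt : ∀ {a d} → D d → Independent a d → Red a d → suc (suc (cnt a d)) ≡ q
  red-cnt d∈D ind red = trans (cong suc (cnt-∈ ind d∈D)) red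

  red-cong : ∀ {a a′ d} → OnLine a d a′ → OnLine a′ d a → Red a d → Red a′ d
  red-cong p p′ red = trans (cong suc (ℕₚ.≤-antisym (ℓ-mono p (onLine-∋₂ _ _)) (ℓ-mono p′ (onLine-∋₂ _ _)))) red

  red-shift : ∀ {a a′ d} s → a′ ≋ a ⊕ s · d → Red a d → Red a′ d
  red-shift {a} {a′} {d} s h = red-cong
    (onLine-resp h (onLine-⊕ (onLine-∋₁ a d) (onLine-· s (onLine-∋₂ a d))))
    (onLine-resp (λ x → lin₁ 1# (h x) (solve 3 (λ a b e → a :+ (b :+ e) := :1 :* (b :+ (a :+ e))) refl
                    (a x) (a′ x) (s * d x)))
      (onLine-⊕ (onLine-∋₁ a′ d) (onLine-· s (onLine-∋₂ a′ d))))

  -- By `see` there is a point Q m + γd in Q. If γ ≠ β, the line ⟨Q m - Q i, d⟩ contains ⟨d⟩ and the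
  -- points with parameters 0, β and γ, coming from the pairs (m, i), (m, j) and (m′, i). These are
  -- four directions, so the line would be red.
  blue-translate : ∀ {i j m β d} → D d → ¬ (β ≡ 0#) → Q j ≋ Q i ⊕ β · d →
                   Independent (Q m ⊕ Q i) d → ¬ Red (Q m ⊕ Q i) d → ∃ λ m′ → Q m′ ≋ Q m ⊕ β · d
  blue-translate {i} {j} {m} {β} {d} d∈D β≢0 h ind blue with see m d∈D
  ... | m′ , m≢m′ , p@(γ , γ≢0 , _) with β ≟ γ
  ... | yes refl = m′ , forward p
  ... | no β≢γ = contradiction (4≤⇒red ind (subst (4 ≤_) (cnt-∈ ind d∈D) (s≤s (cnt-list (0# ∷ β ∷ γ ∷ [])
      (((λ e → β≢0 (sym e)) ∷ (λ e → γ≢0 (sym e)) ∷ []) ∷ (β≢γ ∷ []) ∷ [] ∷ [])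
      (off-ray-D ind i (λ x → solve 2 (λ a d → a := a :+ :0 :* d) refl (Q i x) (d x))
      ∷ off-ray-D ind j h
      ∷ D-diff (λ { refl → back-≢ (forward p) })
               (λ x → lin₁ 1# (forward p x)
                  (solve 4 (λ a b c e → (b :+ a :+ e) :+ (c :+ a) := :1 :* (c :+ (b :+ e))) refl
                    (Q i x) (Q m x) (Q m′ x) (γ * d x)))
      ∷ []))))) blue
    where
    back-≢ : ∀ {s} → ¬ (Q i ≋ Q m ⊕ s · d)
    back-≢ {s} h′ = 0≢1 (sym (proj₁ (ind 1# s λ x → lin₁ 1# (h′ x)
      (solve 3 (λ a b e → (:1 :* (b :+ a) :+ e) :+ :0 := :1 :* (a :+ (b :+ e))) refl
        (Q i x) (Q m x) (s * d x)))))

  -- Projection from a point outside D, and the bound on red lines.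

  module _ {c} (c∉D : ¬ D c) (c≢0 : NonZeroV c) where

    abstract
      -- `Q i` sees the q - 1 directions v + xc at points with nonzero `v`-coordinate. Two of them
      -- with equal coordinate would differ by a multiple of c ∉ D, so together with `Q i` itself,
      -- at coordinate 0, every coordinate occurs.
      fill : ∀ {v} → Independent v c → suc (cnt v c) ≡ q →
             ∀ i s → ∃ λ j → ∃ λ t → Q j ≋ Q i ⊕ s · v ⊕ t · c
      fill {v} ind full i s = subst (λ s → ∃ λ j → ∃ λ t → Q j ≋ Q i ⊕ s · v ⊕ t · c) (el-ix s)
        (all-of-♯ Im? (ℕₚ.≤-trans (ℕₚ.≤-reflexive (sym full)) (ℕₚ.≤-trans (s≤s enough) (♯-∖-≥ Im? (ix 0#)
          (i , 0# , λ x → trans (solve 3 (λ a v c → a := (a :+ :0 :* v) :+ :0 :* c) refl (Q i x) (v x) (c x))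
                                (cong (λ s → Q i x + s * v x + 0# * c x) (sym (el-ix 0#))))))) (ix s))
        where
        Im? : ∀ l → Dec (∃ λ j → ∃ λ t → Q j ≋ Q i ⊕ el l · v ⊕ t · c)
        Im? l = Fin.any? λ j → ∃? λ t → Q j ≋? (Q i ⊕ el l · v ⊕ t · c)

        same : ∀ {j j′ s s′ x y} → s ≡ s′ → ¬ (s ≡ 0#) → Q j ≋ Q i ⊕ s · (v ⊕ x · c) →
               Q j′ ≋ Q i ⊕ s′ · (v ⊕ y · c) → x ≡ y
        same {j} {j′} {s} {x = x} {y} refl s≢0 h h′ with j Fin.≟ j′
        ... | no ne = contradiction (D-join {c = s * (x + y)} ne λ z → lin₂ 1# 1# (h z) (h′ z)
                (solve 8 (λ a b b′ v c s x y → b′ :+ (b :+ s :* (x :+ y) :* c) :=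
                   :1 :* (b :+ (a :+ s :* (v :+ x :* c))) :+ :1 :* (b′ :+ (a :+ s :* (v :+ y :* c)))) refl
                  (Q i z) (Q j z) (Q j′ z) (v z) (c z) s x y)) c∉D
        ... | yes refl = x+y≡0⇒x≡y (x*y≡0⇒y≡0 s≢0 (·-cancelʳ {d = 0#} c≢0 λ z → lin₂ 1# 1# (h z) (h′ z)
                (solve 7 (λ a b v c s x y → s :* (x :+ y) :* c :+ :0 :* c :=
                   :1 :* (b :+ (a :+ s :* (v :+ x :* c))) :+ :1 :* (b :+ (a :+ s :* (v :+ y :* c)))) refl
                  (Q i z) (Q j z) (v z) (c z) s x y)))

        enough : cnt v c ≤ ♯ (Im? ∖ ix 0#)
        enough = ♯-injection (λ l → D? (v ⊕ el l · c)) (Im? ∖ ix 0#)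
          (λ l p → ix (proj₁ (proj₂ (proj₂ (see i p)))))
          (λ l p → let j , _ , p′ = see i p ; s , s≢0 , _ = p′ in
            (j , s * el l , λ x → lin₂ 1# (v x) (forward p′ x) (el-ix s)
              (solve 7 (λ a b v c s l s′ → b :+ (a :+ s′ :* v :+ s :* l :* c) :=
                 :1 :* (b :+ (a :+ s :* (v :+ l :* c))) :+ v :* (s′ :+ s)) refl
                (Q i x) (Q j x) (v x) (c x) s (el l) (el (ix s)))) ,
            λ e → s≢0 (ix-injective e))
          (λ l l′ p p′ e → el-injective (same (ix-injective e) (proj₁ (proj₂ (proj₂ (proj₂ (see i p)))))
            (forward (proj₂ (proj₂ (see i p)))) (forward (proj₂ (proj₂ (see i p′))))))

    -- Converse of `fill`: the points reached at the q - 1 coordinates t ≠ 0 lie in directions v +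
    -- ρc from `Q i`, and `no-three-on` prevents two values of t from sharing one direction.
    full-line : ∀ {v} i → Independent v c → (∀ t → ∃ λ j → ∃ λ r → Q j ≋ Q i ⊕ t · v ⊕ r · c) →
                q ≤ suc (cnt v c)
    full-line {v} i ind reach = ℕₚ.≤-trans (ℕₚ.≤-trans (♯-full ⊤? _) (♯-∖-≤ ⊤? (ix 0#)))
      (s≤s (♯-injection (⊤? ∖ ix 0#) (λ l → D? (v ⊕ el l · c))
        (λ t p → ix (ρ t p)) ρ∈D
        (λ t t′ p p′ e → el-injective (same (≢0 p) (≢0 p′) (ix-injective e) (≢i t p) (≢i t′ p′)
                                            (joined t p) (joined t′ p′)))))
      where
      ≢0 : ∀ {t} → ⊤ × ¬ (t ≡ ix 0#) → ¬ (el t ≡ 0#)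
      ≢0 p e = proj₂ p (el-injective (trans e (sym (el-ix 0#))))

      ρ : ∀ t → ⊤ × ¬ (t ≡ ix 0#) → Carrier
      ρ t p = proj₁ (inverse (el t) (≢0 p)) * proj₁ (proj₂ (reach (el t)))

      joined : ∀ t p → Q (proj₁ (reach (el t))) ≋ Q i ⊕ el t · (v ⊕ ρ t p · c)
      joined t p x = let t⁻¹ , e = inverse (el t) (≢0 p) ; j , r , h = reach (el t) in
        lin₂ 1# (r * c x) (h x) e
          (solve 7 (λ a b v c t t⁻¹ r → b :+ (a :+ t :* (v :+ t⁻¹ :* r :* c)) :=
             :1 :* (b :+ (a :+ t :* v :+ r :* c)) :+ r :* c :* (t :* t⁻¹ :+ :1)) refl
            (Q i x) (Q j x) (v x) (c x) (el t) t⁻¹ r)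

      ≢i : ∀ t p → ¬ (i ≡ proj₁ (reach (el t)))
      ≢i t p e = ≢0 p (proj₁ (ind (el t) (proj₁ (proj₂ (reach (el t)))) λ x →
        lin₁ 1# (trans (cong (λ z → Q z x) e) (proj₂ (proj₂ (reach (el t))) x))
          (solve 3 (λ a b c → (b :+ c) :+ :0 := :1 :* (a :+ (a :+ b :+ c))) refl
            (Q i x) (el t * v x) (proj₁ (proj₂ (reach (el t))) * c x))))

      ρ∈D : ∀ t p → D (v ⊕ el (ix (ρ t p)) · c)
      ρ∈D t p = subst (λ z → D (v ⊕ z · c)) (sym (el-ix (ρ t p))) (D-join (≢i t p) (joined t p))

      same : ∀ {j j′ t t′ x y} → ¬ (t ≡ 0#) → ¬ (t′ ≡ 0#) → x ≡ y → ¬ (i ≡ j) → ¬ (i ≡ j′) →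
             Q j ≋ Q i ⊕ t · (v ⊕ x · c) → Q j′ ≋ Q i ⊕ t′ · (v ⊕ y · c) → t ≡ t′
      same {j} {t = t} {t′} {x} t≢0 t′≢0 refl i≢j i≢j′ h h′ with no-three-on i≢j i≢j′ h h′
      ... | refl = ·-cancelʳ (D-nonzero (D-join i≢j h)) λ z → lin₂ 1# 1# (h z) (h′ z)
        (solve 4 (λ a b w w′ → w :+ w′ := :1 :* (b :+ (a :+ w)) :+ :1 :* (b :+ (a :+ w′))) refl
          (Q i z) (Q j z) (t * (v z + x * c z)) (t′ * (v z + x * c z)))

    -- Through a direction c outside D, a line has at most q − 1 directions and each point of Q sees
    -- all of them; two such full lines ⟨d, c⟩ and ⟨z, c⟩ make every line ⟨z + λd, c⟩ of their plane
    -- full, while the lines ⟨z + ρc, d⟩ have at most q − 2 directions besides d.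
    two-full-lines : ∀ {d z} → D d → Independent d c → suc (cnt d c) ≡ q →
                     ¬ OnLine d c z → suc (cnt z c) ≡ q → ⊥
    two-full-lines {d} {z} d∈D ind full off full′ = absurd {proj₁ bounds} (proj₂ bounds)
      where
      two-less : ∀ {x} → 16 ≤ x → ∃ λ p → suc (suc p) ≡ x
      two-less (s≤s (s≤s {n = p} _)) = p , refl

      absurd : ∀ {p} → suc p ℕ.* ♯ {q} ⊤? ≤ p ℕ.* ♯ {q} ⊤? → ⊥
      absurd {p} h = ℕₚ.<-irrefl refl (ℕₚ.≤-trans
        (ℕₚ.+-monoˡ-≤ _ (ℕₚ.≤-trans (ℕₚ.≤-trans (ℕₚ.m≤m+n 1 15) 16≤q) (♯-full ⊤? _))) h)

      T? : ∀ l r → Dec (D ((z ⊕ el l · d) ⊕ el r · c))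
      T? l r = D? ((z ⊕ el l · d) ⊕ el r · c)

      ind-row : ∀ l → Independent (z ⊕ el l · d) c
      ind-row l = off-plane-indep c≢0 off (onLine-· (el l) (onLine-∋₁ d c))

      ind-z : Independent z c
      ind-z = indep c≢0 (λ (s , h) → off (onLine-resp h (onLine-· s (onLine-∋₂ d c))))

      ind-col : ∀ r → Independent (z ⊕ el r · c) d
      ind-col r = off-plane-indep (D-nonzero d∈D) (λ on → off (onLine-swap on)) (onLine-· (el r) (onLine-∋₁ c d))

      reach : ∀ l t → ∃ λ j → ∃ λ r → Q j ≋ Q zero ⊕ t · (z ⊕ el l · d) ⊕ r · c
      reach l t =
        -- Modulo c, the displacement t(z + ld) splits into tld along the first full line and then
        -- tz along the second.
        let j , r , h = fill ind full zero (t * el l)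
            k , r′ , h′ = fill ind-z full′ j t
        in k , r + r′ , compose {j} {k} {r} {r′} (el l) t h h′
        where
        compose : ∀ {j k r r′} l t → Q j ≋ Q zero ⊕ (t * l) · d ⊕ r · c → Q k ≋ Q j ⊕ t · z ⊕ r′ · c →
                  Q k ≋ Q zero ⊕ t · (z ⊕ l · d) ⊕ (r + r′) · c
        compose {j} {k} {r} {r′} l t h h′ x = lin₂ 1# 1# (h x) (h′ x)
          (solve 10 (λ a b e z d c t l r r′ → e :+ (a :+ t :* (z :+ l :* d) :+ (r :+ r′) :* c) :=
             :1 :* (b :+ (a :+ t :* l :* d :+ r :* c)) :+ :1 :* (e :+ (b :+ t :* z :+ r′ :* c))) refl
            (Q zero x) (Q j x) (Q k x) (z x) (d x) (c x) t l r r′)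

      row : ∀ l → q ≤ suc (♯ (λ r → ⊤? r ×-dec T? l r))
      row l = ℕₚ.≤-trans (full-line zero (ind-row l) (reach l))
        (s≤s (♯-mono (T? l) (λ r → ⊤? r ×-dec T? l r) (λ _ p → tt , p)))

      col : ∀ r → suc (suc (♯ (λ l → ⊤? l ×-dec T? l r))) ≤ q
      col r = ℕₚ.≤-trans (s≤s (s≤s (♯-mono (λ l → ⊤? l ×-dec T? l r) (λ l → D? ((z ⊕ el r · c) ⊕ el l · d))
          (λ l p → D-resp (λ x → solve 3 (λ a b c → (a :+ b) :+ c := (a :+ c) :+ b) refl
                             (z x) (el r * c x) (el l * d x)) (proj₂ p)))))
        (ℕₚ.≤-trans (s≤s (ℕₚ.≤-reflexive (cnt-∈ (ind-col r) d∈D))) (ℓ<q (ind-col r)))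

      bounds : ∃ λ p → suc p ℕ.* ♯ {q} ⊤? ≤ p ℕ.* ♯ {q} ⊤?
      bounds = let p , e = two-less 16≤q in p , double-count ⊤? ⊤? T?
        (λ l _ → ℕₚ.≤-pred (ℕₚ.≤-trans (ℕₚ.≤-reflexive e) (row l)))
        (λ r _ → ℕₚ.≤-pred (ℕₚ.≤-pred (ℕₚ.≤-trans (col r) (ℕₚ.≤-reflexive (sym e)))))

  module _ {d r z} (d∈D : D d) (ind : Independent r d) (red : Red r d) (off : ¬ OnLine d r z) where

    private
      d≢0 = D-nonzero d∈D

    -- A point c ∉ D of ⟨r, d⟩ can be projected along: four lines ⟨z + μr, d⟩ with q − 1 directions
    -- miss at most 8 < q of the lines through c, so some other line through c carries at least 4
    -- directions as well, and two-full-lines applies.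
    few-red : ∀ μs → length μs ≡ 4 → Unique μs →
              All (λ μ → Red (z ⊕ μ · r) d) μs → ⊥
    few-red μs four unique reds with hole d∈D ind
    ... | η , c∉D = go (♯-avoid B? μs (All.map (λ {μ} → two-missing μ) reds)
                          (subst (λ k → k ℕ.* 2 < q) (sym four) (ℕₚ.≤-trans (ℕₚ.m≤m+n 9 7) 16≤q)))
      where
      c : Vect n
      c = r ⊕ η · d

      B? : ∀ μ l → Dec (¬ D ((z ⊕ μ · c) ⊕ el l · d))
      B? μ l = ¬? (D? ((z ⊕ μ · c) ⊕ el l · d))

      on-c : ∀ x → OnLine d r (x · c)
      on-c x = onLine-· x (onLine-⊕ (onLine-∋₂ d r) (onLine-· η (onLine-∋₁ d r)))

      ind-μ : ∀ μ → Independent (z ⊕ μ · c) d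
      ind-μ μ = off-plane-indep d≢0 (λ on → off (onLine-swap on)) (onLine-swap (on-c μ))

      -- The vectors `r` and `c` differ by a multiple of `d`, so both describe the same line through
      -- `d`.
      red-μ : ∀ μ → Red (z ⊕ μ · r) d → Red (z ⊕ μ · c) d
      red-μ μ = red-shift (μ * η) λ x →
        solve 5 (λ z r d μ η → z :+ μ :* (r :+ η :* d) := (z :+ μ :* r) :+ μ :* η :* d) refl
          (z x) (r x) (d x) μ η

      two-missing : ∀ μ → Red (z ⊕ μ · r) d → ♯ (B? μ) ≤ 2
      two-missing μ rd = ℕₚ.+-cancelˡ-≤ (cnt (z ⊕ μ · c) d) _ _ (ℕₚ.≤-trans
        (ℕₚ.≤-reflexive (trans (♯-∁ (λ l → D? ((z ⊕ μ · c) ⊕ el l · d)))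
                               (sym (red-cnt d∈D (ind-μ μ) (red-μ μ rd)))))
        (ℕₚ.≤-reflexive (ℕₚ.+-comm 2 _)))

      c≢0 : NonZeroV c
      c≢0 h = 0≢1 (sym (proj₁ (ind 1# η λ x → lin₁ 1# (h x)
        (solve 3 (λ r d η → (:1 :* r :+ η :* d) :+ :0 := :1 :* ((r :+ η :* d) :+ :0)) refl (r x) (d x) η))))

      ind-dc : Independent d c
      ind-dc = indep-swap (indep d≢0 λ (s , h) → 0≢1 (sym (proj₁ (ind 1# (s + η) λ x → lin₁ 1# (h x)
        (solve 4 (λ r d η s → (:1 :* r :+ (s :+ η) :* d) :+ :0 := :1 :* ((r :+ η :* d) :+ s :* d)) refl
          (r x) (d x) η s)))))

      full : suc (cnt d c) ≡ q
      full = trans (cong suc (cnt-∉ ind-dc c∉D)) (trans (cong suc (ℕₚ.≤-antisym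
          (ℓ-mono (onLine-∋₂ r d) (onLine-⊕ (onLine-∋₁ r d) (onLine-· η (onLine-∋₂ r d))))
          (ℓ-mono (onLine-resp (λ x → solve 3 (λ r d η → r := (r :+ η :* d) :+ η :* d) refl (r x) (d x) η)
                     (onLine-⊕ (onLine-∋₂ d c) (onLine-· η (onLine-∋₁ d c)))) (onLine-∋₁ d c)))) red)

      go : (∃ λ l → All (λ μ → ¬ ¬ D ((z ⊕ μ · c) ⊕ el l · d)) μs) → ⊥
      go (l , ds) = two-full-lines c∉D c≢0 d∈D ind-dc full off′ (trans (cong suc (cnt-∉ ind-z′ c∉D))
          (4≤⇒red ind-z′ (ℕₚ.≤-trans (subst (_≤ cnt z′ c) four
                                        (cnt-list μs unique (All.map (λ {μ} → seen μ) ds)))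
                                     (ℕₚ.≤-reflexive (cnt-∉ ind-z′ c∉D)))))
        where
        z′ : Vect n
        z′ = z ⊕ el l · d

        off′ : ¬ OnLine d c z′
        off′ on = off (onLine-resp (λ x → solve 2 (λ z e → z := (z :+ e) :+ e) refl (z x) (el l * d x))
          (onLine-⊕ (onLine-trans (onLine-∋₁ d r) (onLine-resp (λ x → sym (*-identityˡ (c x))) (on-c 1#)) on)
                    (onLine-· (el l) (onLine-∋₁ d r))))

        ind-z′ : Independent z′ c
        ind-z′ = indep c≢0 (λ (s , h) → off′ (onLine-resp h (onLine-· s (onLine-∋₂ d c))))

        seen : ∀ μ → ¬ ¬ D ((z ⊕ μ · c) ⊕ el l · d) → D (z′ ⊕ μ · c)
        seen μ p = D-resp (λ x → solve 3 (λ a b c → (a :+ b) :+ c := (a :+ c) :+ b) refl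
                             (z x) (el l * d x) (μ * c x)) (decidable-stable (D? _) p)

  -- Translations of Q by its differences.

  red? : ∀ a d → Dec (Red a d)
  red? a d = suc (ℓ a d) ℕ.≟ q

  -- A point `Q w` of the plane through `Q m₀` lies on an affine line Q m₀ + μr + ⟨d⟩, and μ alone
  -- determines the line ⟨z + μr, d⟩ spanned by Q w - Q i and `d`. By `few-red` at most three values
  -- of μ are red, and each affine line has at most two points of Q.
  few-bad : ∀ {i m₀ d r} → D d → Independent r d → Red r d → ¬ OnLine d r (Q m₀ ⊕ Q i) →
            ♯ (λ w → InPlane? m₀ d r w ×-dec red? (Q w ⊕ Q i) d) ≤ 6
  few-bad {i} {m₀} {d} {r} d∈D ind red off = ℕₚ.≤-trans (ℕₚ.≤-reflexive (sym (ℕₚ.+-identityʳ _)))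
    (ℕₚ.≤-trans (double-count {a = 1} {b = 2} Bad? R? T? row col) (ℕₚ.*-monoʳ-≤ 2 (ℕₚ.≤-pred (ℕₚ.≰⇒> three))))
    where
    z : Vect n
    z = Q m₀ ⊕ Q i

    Bad? : ∀ w → Dec (OnLine d r (Q w ⊕ Q m₀) × Red (Q w ⊕ Q i) d)
    Bad? w = InPlane? m₀ d r w ×-dec red? (Q w ⊕ Q i) d

    R? : ∀ l → Dec (Red (z ⊕ el l · r) d)
    R? l = red? (z ⊕ el l · r) d

    T? : ∀ w l → Dec (∃ λ s → Q w ≋ (Q m₀ ⊕ el l · r) ⊕ s · d)
    T? w l = ∃? (λ s → Q w ≋? ((Q m₀ ⊕ el l · r) ⊕ s · d))

    three : ¬ (4 ≤ ♯ R?)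
    three h =
      let ls , four , u , reds = ♯≥⇒unique R? 4 h in
      few-red d∈D ind red off (List.map el ls) (trans (List.length-map el ls) four)
        (Unique.map⁺ el-injective u) (All.map⁺ reds)

    row : ∀ w → OnLine d r (Q w ⊕ Q m₀) × Red (Q w ⊕ Q i) d → 1 ≤ ♯ (λ l → R? l ×-dec T? w l)
    row w ((s , x , h) , rd) = ♯-∋ (λ l → R? l ×-dec T? w l) (ix x)
      ( subst (λ y → Red (z ⊕ y · r) d) (sym (el-ix x))
          (red-shift s (λ y → lin₁ 1# (h y)
            (solve 6 (λ w m i e x r → (m :+ i :+ x :* r) :+ ((w :+ i) :+ e) :=
               :1 :* ((w :+ m) :+ (e :+ x :* r))) refl
              (Q w y) (Q m₀ y) (Q i y) (s * d y) x (r y))) rd)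
      , s , λ y → lin₂ 1# (r y) (h y) (el-ix x)
          (solve 6 (λ w m e x x′ r → w :+ ((m :+ x′ :* r) :+ e) :=
             :1 :* ((w :+ m) :+ (e :+ x :* r)) :+ r :* (x′ :+ x)) refl
            (Q w y) (Q m₀ y) (s * d y) x (el (ix x)) (r y)) )

    difference : ∀ {w w′ s s′ p} → Q w ≋ p ⊕ s · d → Q w′ ≋ p ⊕ s′ · d → Q w′ ≋ Q w ⊕ (s + s′) · d
    difference {w} {w′} {s} {s′} {p} h h′ y = lin₂ 1# 1# (h y) (h′ y)
      (solve 6 (λ w w′ p s s′ d → w′ :+ (w :+ (s :+ s′) :* d) :=
         :1 :* (w :+ (p :+ s :* d)) :+ :1 :* (w′ :+ (p :+ s′ :* d))) refl
        (Q w y) (Q w′ y) (p y) s s′ (d y))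

    col : ∀ l → Red (z ⊕ el l · r) d → ♯ (λ w → Bad? w ×-dec T? w l) ≤ 2
    col l _ = ℕₚ.≤-pred (ℕₚ.≰⇒> λ h → collinear (♯≥⇒unique (λ w → Bad? w ×-dec T? w l) 3 h))
      where
      p : Vect n
      p = Q m₀ ⊕ el l · r

      collinear : (∃ λ ws → length ws ≡ 3 × Unique ws × All (λ w → _ × (∃ λ s → Q w ≋ p ⊕ s · d)) ws) → ⊥
      collinear (w ∷ w′ ∷ w″ ∷ [] , _ , (w≢w′ ∷ w≢w″ ∷ []) ∷ (w′≢w″ ∷ []) ∷ _ ,
                 (_ , s , h) ∷ (_ , s′ , h′) ∷ (_ , s″ , h″) ∷ []) =
        w′≢w″ (no-three-on w≢w′ w≢w″ (difference {p = p} h h′) (difference {p = p} h h″))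

  -- `Q m` sees the directions of ⟨r, d⟩ other than ⟨d⟩ at distinct points, all within its plane.
  plane-rich : ∀ {m d r} → D d → Independent r d → cnt r d ≤ ♯ (InPlane? m d r)
  plane-rich {m} {d} {r} d∈D ind = ♯-injection (λ l → D? (r ⊕ el l · d)) (InPlane? m d r)
    (λ l p → proj₁ (see m p))
    (λ l p → onLine-prop (proj₂ (proj₂ (see m p)))
               (onLine-⊕ (onLine-∋₂ d r) (onLine-· (el l) (onLine-∋₁ d r))))
    (λ l l′ p p′ e → el-injective (shift-injective ind (prop-trans (prop-sym (proj₂ (proj₂ (see m p))))
      (subst (λ j → Proportional (Q j ⊕ Q m) (r ⊕ el l′ · d)) (sym e) (proj₂ (proj₂ (see m p′)))))))

  off-plane : ∀ i {d r} → D d → Independent r d → ∃ λ m → ¬ OnLine d r (Q m ⊕ Q i)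
  off-plane i {d} {r} d∈D ind =
    let m , _ , off = ♯-witness-∖ (InPlane? i d r) ⊤?
          (ℕₚ.≤-trans (s≤s (ℕₚ.≤-trans (plane-bound d∈D ind) q≤M)) (♯-full ⊤? _))
    in m , off

  module _ {i j β d} (d∈D : D d) (β≢0 : ¬ (β ≡ 0#)) (i≢j : ¬ (i ≡ j)) (h : Q j ≋ Q i ⊕ β · d) where

    -- When ⟨d, Qₘ − Qᵢ⟩ has q − 1 directions, pass through a point w of a parallel plane for which
    -- neither ⟨d, w − Qᵢ⟩ nor ⟨d, w − Qₘ⟩ does.
    red-translate : ∀ {m} → Independent (Q m ⊕ Q i) d → Red (Q m ⊕ Q i) d → ∃ λ m′ → Q m′ ≋ Q m ⊕ β · d
    red-translate {m} ind red with off-plane i d∈D ind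
    ... | m₀ , off = go (♯-witness-∖ Bad? Plane? few)
      where
      r z : Vect n
      r = Q m ⊕ Q i
      z = Q m₀ ⊕ Q i

      Plane? = InPlane? m₀ d r

      Bad₁? : ∀ w → Dec (OnLine d r (Q w ⊕ Q m₀) × Red (Q w ⊕ Q i) d)
      Bad₁? w = InPlane? m₀ d r w ×-dec red? (Q w ⊕ Q i) d

      Bad₂? : ∀ w → Dec (OnLine d r (Q w ⊕ Q m₀) × Red (Q w ⊕ Q m) d)
      Bad₂? w = InPlane? m₀ d r w ×-dec red? (Q w ⊕ Q m) d

      Bad? : ∀ w → Dec _
      Bad? w = Bad₁? w ⊎-dec Bad₂? w

      off′ : ¬ OnLine d r (Q m₀ ⊕ Q m)
      off′ on = off (onLine-resp
        (λ x → solve 3 (λ a b c → a :+ c := (a :+ b) :+ (b :+ c)) refl (Q m₀ x) (Q m x) (Q i x))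
        (onLine-⊕ on (onLine-∋₂ d r)))

      few : ♯ Bad? ℕ.< ♯ Plane?
      -- `few-bad` is applied from `Q i` and from `Q m`, giving at most 12 bad points; `plane-rich`
      -- gives at least q - 2 ≥ 14 candidates.
      few = ℕₚ.≤-trans (s≤s (ℕₚ.≤-trans (♯-∪ Bad? Bad₁? Bad₂? (λ _ b → b))
              (ℕₚ.+-mono-≤ (few-bad d∈D ind red off) (few-bad d∈D ind red off′))))
        (ℕₚ.≤-trans (ℕₚ.≤-trans (ℕₚ.m≤m+n 13 1) (ℕₚ.≤-pred (ℕₚ.≤-pred
          (ℕₚ.≤-trans 16≤q (ℕₚ.≤-reflexive (sym (red-cnt d∈D ind red))))))) (plane-rich d∈D ind))

      go : (∃ λ w → OnLine d r (Q w ⊕ Q m₀) × ¬ _) → ∃ λ m′ → Q m′ ≋ Q m ⊕ β · d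
      go (w , on , ¬bad) =
        let w′ , h′ = blue-translate d∈D β≢0 h ind-w (λ rd → ¬bad (inj₁ (on , rd)))
        -- Q w - Q m and Q m - Q w agree in characteristic 2, but only pointwise; `red-shift` with
        -- coefficient 0 carries redness across.
        in blue-translate d∈D β≢0 h′ ind-m (λ rd → ¬bad (inj₂ (on , red-shift 0# sym-shift rd)))
        where
        ind-w : Independent (Q w ⊕ Q i) d
        ind-w = indep (D-nonzero d∈D) λ (s , e) → off (onLine-resp
          (λ x → lin₁ 1# (e x) (solve 4 (λ m₀ i w e → (m₀ :+ i) :+ ((w :+ m₀) :+ e) := :1 :* ((w :+ i) :+ e)) refl
             (Q m₀ x) (Q i x) (Q w x) (s * d x)))
          (onLine-⊕ on (onLine-· s (onLine-∋₁ d r))))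

        ind-m : Independent (Q m ⊕ Q w) d
        ind-m = indep (D-nonzero d∈D) λ (s , e) → off′ (onLine-resp
          (λ x → lin₁ 1# (e x) (solve 4 (λ m₀ m w e → (m₀ :+ m) :+ ((w :+ m₀) :+ e) := :1 :* ((m :+ w) :+ e)) refl
             (Q m₀ x) (Q m x) (Q w x) (s * d x)))
          (onLine-⊕ on (onLine-· s (onLine-∋₁ d r))))

        sym-shift : Q w ⊕ Q m ≋ (Q m ⊕ Q w) ⊕ 0# · d
        sym-shift x = solve 3 (λ w m d → w :+ m := (m :+ w) :+ :0 :* d) refl (Q w x) (Q m x) (d x)

    indep-translate : ∀ {m} → Independent (Q m ⊕ Q i) d → Dec (Red (Q m ⊕ Q i) d) →
                      ∃ λ m′ → Q m′ ≋ Q m ⊕ β · d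
    indep-translate ind (yes red)  = red-translate ind red
    indep-translate ind (no  blue) = blue-translate d∈D β≢0 h ind blue

    translate : ∀ m → ∃ λ m′ → Q m′ ≋ Q m ⊕ β · d
    translate m with i Fin.≟ m | ∃? (λ s → (Q m ⊕ Q i) ≋? (s · d))
    ... | yes refl | _ = j , h
    ... | no i≢m | no ¬p = indep-translate (indep (D-nonzero d∈D) ¬p) (red? (Q m ⊕ Q i) d)
    -- Here `Q m` lies on the line through `Q i` and `Q j`, so m = j because no three points are
    -- collinear. Its translate is `Q i`, as βd + βd = 0.
    ... | no i≢m | yes (s , p) with no-three-on i≢j i≢m h (λ x → lin₁ 1# (p x)
            (solve 3 (λ m i e → m :+ (i :+ e) := :1 :* ((m :+ i) :+ e)) refl (Q m x) (Q i x) (s * d x)))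
    ... | refl = i , λ x → lin₁ 1# (h x)
            (solve 3 (λ i j e → i :+ (j :+ e) := :1 :* (j :+ (i :+ e))) refl (Q i x) (Q j x) (β * d x))

  parallelogram : ∀ i j m → ∃ λ m′ → Q m′ ≋ Q m ⊕ (Q j ⊕ Q i)
  parallelogram i j m with i Fin.≟ j
  ... | yes refl = m , λ x → solve 2 (λ m i → m := m :+ (i :+ i)) refl (Q m x) (Q i x)
  ... | no i≢j =
    let m′ , h = translate (D-diff (λ e → i≢j (sym e)) (λ _ → refl)) (λ e → 0≢1 (sym e)) i≢j
                   (λ x → solve 2 (λ i j → j := i :+ :1 :* (j :+ i)) refl (Q i x) (Q j x)) m
    in m′ , λ x → trans (h x) (cong (Q m x +_) (*-identityˡ _))

-- The F₂-subspace of differences.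

-- The condition q < N ensures that Q is contained neither in an affine line nor in any plane
-- subject to `plane-bound`; for N = q^k it follows from k ≥ 2.
F₂-linear-directions : ∀ {q n} N (F : GF q) → GF._+_ F (GF.1# F) (GF.1# F) ≡ GF.0# F → 16 ≤ q → q ℕ.< N →
  (Q : Fin N → Geometry.Vect F n) →
  (∀ i j → Geometry._≋_ F (Q i) (Q j) → i ≡ j) →
  Geometry.HasSize F (Geometry.Directions F Q) (N ∸ 1) →
  Geometry.LineCondition F (Geometry.Directions F Q) →
  Σ (Geometry.Vect F n → Set) λ U →
    Geometry.IsF₂Subspace F U ×
    (∀ v → Geometry.NonZeroV F v →
      (Geometry.Directions F Q (Geometry.atInfinity F v) →
         ∃ λ u → U u × Geometry.NonZeroV F u × Geometry.Proportional F v u) ×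
      ((∃ λ u → U u × Geometry.NonZeroV F u × Geometry.Proportional F v u) →
         Geometry.Directions F Q (Geometry.atInfinity F v)))
F₂-linear-directions {n = n} (ℕ.suc M) F 1+1≡0 16≤q q<N Q Q-injective size lines =
  U , (U-zero , U-⊕ , U-·) , λ v _ → to , from
  where
  open Translation F 1+1≡0 Q Q-injective size lines 16≤q (ℕₚ.≤-pred q<N)

  U : Vect n → Set
  U v = ∃ λ j → v ≋ Q j ⊕ Q zero

  U-zero : U zeroV
  U-zero = zero , λ x → sym (x+x≡0 (Q zero x))

  U-⊕ : ∀ u w → U u → U w → U (u ⊕ w)
  U-⊕ u w (j , h) (k , h′) = let m , e = parallelogram zero j k in
    m , λ x → lin₃ 1# 1# 1# (h x) (h′ x) (e x)
      (solve 6 (λ u w a b c m → (u :+ w) :+ (m :+ a) :=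
         :1 :* (u :+ (b :+ a)) :+ :1 :* (w :+ (c :+ a)) :+ :1 :* (m :+ (c :+ (b :+ a)))) refl
        (u x) (w x) (Q zero x) (Q j x) (Q k x) (Q m x))

  U-· : ∀ c u → c ≡ 0# ⊎ c ≡ 1# → U u → U (c · u)
  U-· c u (inj₁ refl) _ = zero , λ x → trans (zeroˡ (u x)) (sym (x+x≡0 (Q zero x)))
  U-· c u (inj₂ refl) (j , h) = j , λ x → trans (*-identityˡ (u x)) (h x)

  to : ∀ {v} → Directions Q (atInfinity v) → ∃ λ u → U u × NonZeroV u × Proportional v u
  -- Every direction is visible from the base point, so differences with `Q zero` already represent
  -- all of D.
  to dir = let j , 0≢j , p = see zero (dir⇒D dir) in
    Q j ⊕ Q zero , (j , λ _ → refl) ,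
    D-nonzero (D-diff (λ e → 0≢j (sym e)) (λ _ → refl)) , prop-sym p

  from : ∀ {v} → (∃ λ u → U u × NonZeroV u × Proportional v u) → Directions Q (atInfinity v)
  from (u , (j , h) , u≢0 , p) = D⇒dir (D-prop p (D-diff j≢0 h))
    where
    j≢0 : ¬ (j ≡ zero)
    j≢0 refl = u≢0 (λ x → trans (h x) (x+x≡0 (Q zero x)))

open import Data.Nat using (_*_)

theorem3p7 : (h k : ℕ) → 4 ≤ h → 2 ≤ k →
    (F : GF (2 ^ h)) →
    (Q : Fin ((2 ^ h) ^ k) → Geometry.Vect F (2 * k)) →
    (∀ i j → Geometry._≋_ F (Q i) (Q j) → i ≡ j) →
    Geometry.HasSize F (Geometry.Directions F Q) ((2 ^ h) ^ k ∸ 1) →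
    Geometry.LineCondition F (Geometry.Directions F Q) →
    Σ (Geometry.Vect F (2 * k) → Set) λ U →
    Geometry.IsF₂Subspace F U ×
    (∀ v → Geometry.NonZeroV F v →
    (Geometry.Directions F Q (Geometry.atInfinity F v) →
    ∃ λ u → U u × Geometry.NonZeroV F u × Geometry.Proportional F v u) ×
    ((∃ λ u → U u × Geometry.NonZeroV F u × Geometry.Proportional F v u) →
    Geometry.Directions F Q (Geometry.atInfinity F v)))
theorem3p7 h k 4≤h 2≤k F = F₂-linear-directions _ F (char-2 h F) 16≤q q<qᵏ
  where
  16≤q : 16 ≤ 2 ^ h
  16≤q = ℕₚ.^-monoʳ-≤ 2 4≤h

  q<qᵏ : 2 ^ h ℕ.< (2 ^ h) ^ k
  q<qᵏ = ℕₚ.≤-trans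
    (ℕₚ.≤-reflexive (cong ℕ.suc (sym (ℕₚ.*-identityʳ (2 ^ h)))))
    (ℕₚ.^-monoʳ-< (2 ^ h) (ℕₚ.≤-trans (ℕₚ.m≤m+n 2 14) 16≤q) 2≤k)
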